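{- The problem Uniform Cluster Edge Deletion (UCED), parameterized by the solution size $k$, admits a kernel with at most $6k$ vertices.
   Context: All graphs are finite, simple and undirected. A uniform cluster graph is a graph that is a disjoint union of cliques, all of the same size. UCED: Input: a graph $G=(V,E)$ and a positive integer $k$. Question: is there a set $F\subseteq E$ with $|F|\le k$ such that $G-F=(V,E\setminus F)$ is a uniform cluster graph? A kernel with at most $f(k)$ vertices for a parameterized graph problem is a polynomial-time algorithm that maps every instance $(G,k)$ to an instance $(G',k')$ of the same problem such that $(G,k)$ is a yes-instance if and only if $(G',k')$ is a yes-instance, $|V(G')|\le f(k)$, and $k'$ is bounded by a computable function of $k$. -}

module Defs where

open import Data.Bool using (Bool; true; false; T; T?; _∧_; not; if_then_else_)
open import Data.Fin using (Fin; toℕ; fromℕ<; remQuot; _<?_; _≟_)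
open import Data.List using (List; length; filter; allFin; cartesianProduct)
open import Data.Nat using (ℕ; suc; _+_; _*_; _∸_; _^_; _≤_; _<_; _≡ᵇ_)
open import Data.Nat.Logarithm using (⌊log₂_⌋)
import Data.Nat as ℕ
open import Data.Product using (∃-syntax; _×_; _,_)
open import Function.Bundles using (_⇔_)
open import Relation.Binary.PropositionalEquality
  using (_≡_; _≢_; cong₂; cong)
open import Relation.Nullary using (yes; no)
open import Relation.Nullary.Decidable using (_×-dec_)

-- A set of unordered pairs of distinct elements of Fin n, given by its
-- symmetric irreflexive characteristic function.
record EdgeSet (n : ℕ) : Set where
  field
    has    : Fin n → Fin n → Bool
    sym    : ∀ u v → has u v ≡ has v u
    irrefl : ∀ u → has u u ≡ false

open EdgeSet public using (has)

_⊆ₑ_ : ∀ {n} → EdgeSet n → EdgeSet n → Set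
F ⊆ₑ E = ∀ u v → T (has F u v) → T (has E u v)

_∖ₑ_ : ∀ {n} → EdgeSet n → EdgeSet n → EdgeSet n
E ∖ₑ F = record
  { has    = λ u v → has E u v ∧ not (has F u v)
  ; sym    = λ u v → cong₂ (λ a b → a ∧ not b) (EdgeSet.sym E u v) (EdgeSet.sym F u v)
  ; irrefl = λ u → cong (_∧ not (has F u u)) (EdgeSet.irrefl E u)
  }

-- Each edge is counted once, as the pair (u , v) with u < v.
∣_∣ₑ : ∀ {n} → EdgeSet n → ℕ
∣_∣ₑ {n} F =
  length (filter (λ (u , v) → (u <? v) ×-dec T? (has F u v))
                 (cartesianProduct (allFin n) (allFin n)))

record Graph : Set where
  constructor graph
  field
    order : ℕ
    edges : EdgeSet order

  adj : Fin order → Fin order → Bool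
  adj = has edges

open Graph public

_-ₑ_ : (G : Graph) → EdgeSet (order G) → Graph
G -ₑ F = graph (order G) (edges G ∖ₑ F)

-- The cliques are the fibres of `clique`: the vertex set is partitioned into
-- #cliques parts, each with exactly `size` vertices.
record UniformCluster (G : Graph) : Set where
  field
    #cliques : ℕ
    size     : ℕ
    clique   : Fin (order G) → Fin #cliques
    adjacent : ∀ u v → T (adj G u v) ⇔ (u ≢ v × clique u ≡ clique v)
    uniform  : ∀ i → length (filter (λ v → clique v ≟ i) (allFin (order G))) ≡ size

record Instance : Set where
  constructor inst
  field
    G   : Graph
    k   : ℕ
    k>0 : 0 < k

open Instance public

ParameterizedGraphProblem : Set₁
ParameterizedGraphProblem = Instance → Set

UCED : ParameterizedGraphProblem
UCED I = ∃[ F ] F ⊆ₑ edges (G I) × ∣ F ∣ₑ ≤ k I × UniformCluster (G I -ₑ F)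

-- Model of computation: structured random-access programs at unit cost.
-- Memory consists of arrays of natural numbers, named by numerals in the
-- program text and indexed dynamically; a scalar is a cell such as a [ lit 0 ].
-- The only arithmetic is addition and truncated subtraction, so t steps
-- lengthen stored numbers by O(t) bits and the model is polynomially
-- equivalent to Turing machines.  (Unit-cost multiplication would break this.)

data Expr : Set where
  lit       : ℕ → Expr
  _[_]      : ℕ → Expr → Expr
  _⊕_ _⊖_   : Expr → Expr → Expr

infixl 6 _⊕_ _⊖_

data Program : Set where
  skip          : Program
  _[_]≔_        : ℕ → Expr → Expr → Program
  _⨟_           : Program → Program → Program
  If_Then_Else_ : Expr → Program → Program → Program
  While_Do_    : Expr → Program → Program

infix  5 _[_]≔_
infixr 4 _⨟_

State : Set
State = ℕ → ℕ → ℕ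

eval : Expr → State → ℕ
eval (lit n)  s = n
eval (a [ e ]) s = s a (eval e s)
eval (e ⊕ f)  s = eval e s + eval f s
eval (e ⊖ f)  s = eval e s ∸ eval f s

_[_,_↦_] : State → ℕ → ℕ → ℕ → State
(s [ a , i ↦ x ]) b j = if (a ≡ᵇ b) ∧ (i ≡ᵇ j) then x else s b j

-- ⟨ p , s ⟩⇓[ t ] s′ : p started in s halts in s′ after t steps.
-- A guard is true when its value is nonzero.
data ⟨_,_⟩⇓[_]_ : Program → State → ℕ → State → Set where
  skip   : ∀ {s} → ⟨ skip , s ⟩⇓[ 1 ] s
  assign : ∀ {a e f s} →
           ⟨ a [ e ]≔ f , s ⟩⇓[ 1 ] (s [ a , eval e s ↦ eval f s ])
  seq    : ∀ {p q s s′ s″ t t′} →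
           ⟨ p , s ⟩⇓[ t ] s′ → ⟨ q , s′ ⟩⇓[ t′ ] s″ →
           ⟨ p ⨟ q , s ⟩⇓[ t + t′ ] s″
  then′  : ∀ {e p q s s′ t} → eval e s ≢ 0 → ⟨ p , s ⟩⇓[ t ] s′ →
           ⟨ If e Then p Else q , s ⟩⇓[ suc t ] s′
  else′  : ∀ {e p q s s′ t} → eval e s ≡ 0 → ⟨ q , s ⟩⇓[ t ] s′ →
           ⟨ If e Then p Else q , s ⟩⇓[ suc t ] s′
  exit   : ∀ {e p s} → eval e s ≡ 0 →
           ⟨ While e Do p , s ⟩⇓[ 1 ] s
  iterate : ∀ {e p s s′ s″ t t′} → eval e s ≢ 0 →
           ⟨ p , s ⟩⇓[ t ] s′ → ⟨ While e Do p , s′ ⟩⇓[ t′ ] s″ →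
           ⟨ While e Do p , s ⟩⇓[ suc (t + t′) ] s″

Computable : (ℕ → ℕ) → Set
Computable g =
  ∃[ p ] ∀ m → ∃[ t ] ∃[ s ] ⟨ p , input m ⟩⇓[ t ] s × s 1 0 ≡ g m
  where
  input : ℕ → State
  input m 0 0 = m
  input m _ _ = 0

bit : Bool → ℕ
bit b = if b then 1 else 0

-- Array 0 holds the number of vertices and the parameter, array 1 the
-- adjacency matrix in row-major order; every other cell is 0.
encode : Instance → State
encode I 0 0 = order (G I)
encode I 0 1 = k I
encode I 1 m with m ℕ.<? order (G I) * order (G I)
... | yes m<n² = let (u , v) = remQuot (order (G I)) (fromℕ< m<n²)
                 in bit (adj (G I) u v)
... | no  _    = 0
encode I _ _ = 0

-- The same layout, in arrays 2 and 3; other cells are scratch space.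
Outputs : State → Instance → Set
Outputs s I =
  s 2 0 ≡ order (G I) ×
  s 2 1 ≡ k I ×
  (∀ u v → s 3 (order (G I) * toℕ u + toℕ v) ≡ bit (adj (G I) u v))

-- Number of bits of the adjacency matrix and of k in binary.
inputLength : Instance → ℕ
inputLength I = order (G I) * order (G I) + suc ⌊log₂ k I ⌋

PolynomialTime : (Instance → Instance) → Set
PolynomialTime φ =
  ∃[ p ] ∃[ c ] ∃[ d ] ∀ I → ∃[ t ] ∃[ s ]
    ⟨ p , encode I ⟩⇓[ t ] s × Outputs s (φ I) × t ≤ c * inputLength I ^ d + c

record KernelWithAtMost_VerticesFor_ (f : ℕ → ℕ) (Π : ParameterizedGraphProblem) : Set where
  field
    kernel         : Instance → Instance
    polynomialTime : PolynomialTime kernel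
    equivalent     : ∀ I → Π I ⇔ Π (kernel I)
    order≤         : ∀ I → order (G (kernel I)) ≤ f (k I)
    bound          : ℕ → ℕ
    computable     : Computable bound
    k′≤            : ∀ I → k (kernel I) ≤ bound (k I)

{-# OPTIONS --safe #-}

-- Let n > 6k and suppose that deleting at most k edges leaves cliques of size s = r + 1.  Every degree
-- is at least r and the excesses deg v - r sum to twice the number of deletions, hence to at most 2k.
-- So r is the minimum degree, and the number of deletions needed depends on r alone: only the
-- existence of a partition into (r + 1)-cliques is in question.
--
-- Call c a center if its closed neighbourhood N[c] is an (r + 1)-clique of total excess at most r - 1.
-- An (r + 1)-clique that meets N[c] without being N[c] would cause an excess of at least r in N[c],
-- so N[c] is a part of every such partition and may be removed.  A part that is not of this form has
-- excess at least max(r, 1), because otherwise one of its vertices is untouched and is a center.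
-- Counting excesses, the remaining vertices together with one N[c] number at most 6k.  This last
-- clique is kept because its center forbids larger cliques in the reduced graph; the new
-- parameter forbids smaller ones.
--
-- All data of the reduction are nested sums over the vertices, so they are written as terms of a
-- small language for which polynomial-time compilation is proved once and for all.

module Submission where

open import Algebra.Properties.CommutativeSemigroup using (interchange)
open import Data.Bool using (Bool; true; false; T; _∧_; _∨_; not; if_then_else_)
open import Data.Bool.Properties using (T-∧; T-∨; T?)
open import Data.Empty using (⊥; ⊥-elim)
open import Data.Fin using (Fin; zero; suc; toℕ; fromℕ<; combine; remQuot; _≟_)
open import Data.Fin.Properties
  using (toℕ<n; toℕ-fromℕ<; fromℕ<-toℕ; toℕ-injective; fromℕ<-cong; toℕ-combine; remQuot-combine)
open import Data.List using (length; filter; allFin; tabulate; cartesianProduct; _++_; map)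
open import Data.List.Properties using (map-tabulate; filter-++; length-++)
open import Data.Nat hiding (_≟_)
import Data.Nat as ℕ
open import Data.Nat.Properties hiding (_≟_)
open import Data.Nat.Tactic.RingSolver using (solve-∀)
open import Data.Product using (∃-syntax; _×_; _,_; proj₁; proj₂)
open import Data.Sum using (_⊎_; inj₁; inj₂; [_,_]′)
open import Data.Unit using (⊤; tt)
open import Data.Vec using (Vec; []; _∷_; lookup)
open import Function using (_∘_)
open import Function.Bundles using (_⇔_; mk⇔; module Equivalence)
open import Relation.Binary.PropositionalEquality hiding ([_])
open import Relation.Nullary using (yes; no; ¬_; does; Dec)
open import Relation.Unary using (Decidable)
open import Defs

-- Finite sums and cardinalities below a bound

-- The reduction also runs on instances without a solution, where none of the counting holds. Hence
-- each consequence of a solution that the converse direction uses is an explicit test in `accepts`,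
-- and an instance with more than 6k vertices that fails a test is mapped to a fixed no-instance. A
-- second obstacle is that excess bounds r in terms of k only through a part that contains a vertex
-- near no center. If every vertex is near a center, r can be arbitrarily large compared with k;
-- then the last N[c] is dropped as well and the empty graph remains.

T-ext : ∀ {x y} → (T x → T y) → (T y → T x) → x ≡ y
T-ext {true}  {true}  f g = refl
T-ext {false} {false} f g = refl
T-ext {true}  {false} f g = ⊥-elim (f tt)
T-ext {false} {true}  f g = ⊥-elim (g tt)

not⁺ : ∀ {x} → ¬ T x → T (not x)
not⁺ {true}  f = f tt
not⁺ {false} f = tt

not⁻ : ∀ {x} → T (not x) → ¬ T x
not⁻ {false} p = λ ()

¬not⁻ : ∀ {x} → ¬ T (not x) → T x
¬not⁻ {true}  _ = tt
¬not⁻ {false} f = f tt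

∧⁺ : ∀ {x y} → T x → T y → T (x ∧ y)
∧⁺ p q = Equivalence.from T-∧ (p , q)

∧⁻ : ∀ {x y} → T (x ∧ y) → T x × T y
∧⁻ = Equivalence.to T-∧

∨⁻ : ∀ {x y} → T (x ∨ y) → T x ⊎ T y
∨⁻ = Equivalence.to T-∨

∨⁺₁ : ∀ {x y} → T x → T (x ∨ y)
∨⁺₁ p = Equivalence.from T-∨ (inj₁ p)

∨⁺₂ : ∀ {x y} → T y → T (x ∨ y)
∨⁺₂ {x} p = Equivalence.from (T-∨ {x}) (inj₂ p)

if-true : ∀ {A : Set} {b} {x y : A} → T b → (if b then x else y) ≡ x
if-true {b = true} _ = refl

if-false : ∀ {A : Set} {b} {x y : A} → ¬ T b → (if b then x else y) ≡ y
if-false {b = false} _ = refl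
if-false {b = true}  f = ⊥-elim (f tt)

bit≤1 : ∀ b → bit b ≤ 1
bit≤1 true  = ≤-refl
bit≤1 false = z≤n

bit-mono : ∀ {x y} → (T x → T y) → bit x ≤ bit y
bit-mono {false}         _ = z≤n
bit-mono {true}  {true}  _ = ≤-refl
bit-mono {true}  {false} f = ⊥-elim (f tt)

∑ : ℕ → (ℕ → ℕ) → ℕ
∑ zero    f = 0
∑ (suc n) f = ∑ n f + f n

∑-cong : ∀ n {f g} → (∀ i → i < n → f i ≡ g i) → ∑ n f ≡ ∑ n g
∑-cong zero    p = refl
∑-cong (suc n) p = cong₂ _+_ (∑-cong n λ i i<n → p i (m<n⇒m<1+n i<n)) (p n ≤-refl)

∑-mono : ∀ n {f g} → (∀ i → i < n → f i ≤ g i) → ∑ n f ≤ ∑ n g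
∑-mono zero    p = z≤n
∑-mono (suc n) p = +-mono-≤ (∑-mono n λ i i<n → p i (m<n⇒m<1+n i<n)) (p n ≤-refl)

∑-+ : ∀ n (f g : ℕ → ℕ) → ∑ n (λ i → f i + g i) ≡ ∑ n f + ∑ n g
∑-+ zero    f g = refl
∑-+ (suc n) f g = trans (cong (_+ (f n + g n)) (∑-+ n f g)) (interchange +-commutativeSemigroup (∑ n f) (∑ n g) (f n) (g n))

∑-const : ∀ n c → ∑ n (λ _ → c) ≡ n * c
∑-const zero    c = refl
∑-const (suc n) c = trans (cong (_+ c) (∑-const n c)) (+-comm (n * c) c)

∑-* : ∀ n f c → ∑ n (λ i → f i * c) ≡ ∑ n f * c
∑-* zero    f c = refl
∑-* (suc n) f c = trans (cong (_+ f n * c) (∑-* n f c)) (sym (*-distribʳ-+ c (∑ n f) (f n)))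

∑-swap : ∀ m n (f : ℕ → ℕ → ℕ) → ∑ m (λ i → ∑ n (λ j → f i j)) ≡ ∑ n (λ j → ∑ m (λ i → f i j))
∑-swap zero    n f = sym (trans (∑-const n 0) (*-zeroʳ n))
∑-swap (suc m) n f = trans (cong (_+ ∑ n (f m)) (∑-swap m n f)) (sym (∑-+ n (λ j → ∑ m (λ i → f i j)) (f m)))

∑-suc : ∀ n f → ∑ (suc n) f ≡ f 0 + ∑ n (f ∘ suc)
∑-suc zero    f = +-comm 0 (f 0)
∑-suc (suc n) f = trans (cong (_+ f (suc n)) (∑-suc n f)) (+-assoc (f 0) _ _)

term≤∑ : ∀ n {f i} → i < n → f i ≤ ∑ n f
term≤∑ (suc n) {f} {i} i<1+n with m≤n⇒m<n∨m≡n (≤-pred i<1+n)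
... | inj₁ i<n  = ≤-trans (term≤∑ n i<n) (m≤m+n _ _)
... | inj₂ refl = m≤n+m _ _

∑-pos : ∀ n {f} → 0 < ∑ n f → ∃[ i ] i < n × 0 < f i
∑-pos (suc n) {f} p with f n in eq
... | suc x = n , ≤-refl , subst (0 <_) (sym eq) (s≤s z≤n)
... | zero  with i , i<n , q ← ∑-pos n (subst (0 <_) (+-identityʳ _) p) = i , m<n⇒m<1+n i<n , q

# : ℕ → (ℕ → Bool) → ℕ
# n P = ∑ n (bit ∘ P)

#-cong : ∀ n {P Q} → (∀ i → i < n → (T (P i) → T (Q i)) × (T (Q i) → T (P i))) → # n P ≡ # n Q
#-cong n p = ∑-cong n λ i i<n → cong bit (T-ext (proj₁ (p i i<n)) (proj₂ (p i i<n)))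

#-empty : ∀ n {P} → (∀ i → i < n → ¬ T (P i)) → # n P ≡ 0
#-empty n empty = trans (#-cong n λ i i<n → empty i i<n , ⊥-elim) (trans (∑-const n 0) (*-zeroʳ n))

#-mono : ∀ n {P Q} → (∀ i → i < n → T (P i) → T (Q i)) → # n P ≤ # n Q
#-mono n p = ∑-mono n λ i i<n → bit-mono (p i i<n)

#-pos⁻ : ∀ n {P} → 0 < # n P → ∃[ i ] i < n × T (P i)
#-pos⁻ n {P} p with i , i<n , q ← ∑-pos n p = i , i<n , pos q
  where
  pos : ∀ {b} → 0 < bit b → T b
  pos {true} _ = tt

#-pos⁺ : ∀ n {P i} → i < n → T (P i) → 0 < # n P
#-pos⁺ n {P} {i} i<n p = ≤-trans (bit-mono {true} λ _ → p) (term≤∑ n {bit ∘ P} i<n)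

#≤ : ∀ n P → # n P ≤ n
#≤ n P = ≤-trans (∑-mono n λ i _ → bit≤1 (P i)) (≤-reflexive (trans (∑-const n 1) (*-identityʳ n)))

#-strict : ∀ n {P Q j} → j < n → (∀ i → i < n → T (P i) → T (Q i)) → ¬ T (P j) → T (Q j) → # n P < # n Q
#-strict (suc n) {P} {Q} {j} j<1+n P⊆Q ¬Pj Qj with m≤n⇒m<n∨m≡n (≤-pred j<1+n)
... | inj₁ j<n  = +-mono-<-≤ (#-strict n j<n (λ i i<n → P⊆Q i (m<n⇒m<1+n i<n)) ¬Pj Qj) (bit-mono (P⊆Q n ≤-refl))
... | inj₂ refl = +-mono-≤-< (#-mono n λ i i<n → P⊆Q i (m<n⇒m<1+n i<n)) (strict ¬Pj Qj)
  where
  strict : ∀ {x y} → ¬ T x → T y → bit x < bit y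
  strict {false} {true} _ _ = ≤-refl
  strict {true}         f _ = ⊥-elim (f tt)

#-⊇ : ∀ n {P Q} → (∀ i → i < n → T (P i) → T (Q i)) → # n Q ≤ # n P → ∀ i → i < n → T (Q i) → T (P i)
#-⊇ n {P} P⊆Q Q≤P i i<n Qi with T? (P i)
... | yes p = p
... | no ¬p = ⊥-elim (<⇒≱ (#-strict n i<n P⊆Q ¬p Qi) Q≤P)

#-not : ∀ n (P : ℕ → Bool) → # n P + # n (not ∘ P) ≡ n
#-not n P = trans (sym (∑-+ n _ _)) (trans (∑-cong n λ i _ → one (P i)) (trans (∑-const n 1) (*-identityʳ n)))
  where
  one : ∀ b → bit b + bit (not b) ≡ 1
  one true  = refl
  one false = refl

#-split : ∀ n (P Q : ℕ → Bool) → # n P ≡ # n (λ i → P i ∧ Q i) + # n (λ i → P i ∧ not (Q i))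
#-split n P Q = trans (∑-cong n λ i _ → split (P i) (Q i)) (∑-+ n _ _)
  where
  split : ∀ x y → bit x ≡ bit (x ∧ y) + bit (x ∧ not y)
  split false _     = refl
  split true  true  = refl
  split true  false = refl

#-single : ∀ n v → v < n → # n (λ i → i ≡ᵇ v) ≡ 1
#-single (suc n) v v<1+n with m≤n⇒m<n∨m≡n (≤-pred v<1+n)
... | inj₁ v<n  = cong₂ _+_ (#-single n v v<n) (cong bit (T-ext {n ≡ᵇ v} {false} (λ e → <⇒≢ v<n (sym (≡ᵇ⇒≡ n v e))) ⊥-elim))
... | inj₂ refl = cong₂ _+_
  (trans (∑-cong n λ i i<n → cong bit (T-ext {i ≡ᵇ n} {false} (λ e → <⇒≢ i<n (≡ᵇ⇒≡ i n e)) ⊥-elim))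
         (trans (∑-const n 0) (*-zeroʳ n)))
  (cong bit (T-ext {n ≡ᵇ n} {true} _ λ _ → ≡⇒≡ᵇ n n refl))

any : ℕ → (ℕ → Bool) → Bool
any n P = 0 <ᵇ # n P

any⁺ : ∀ n {P i} → i < n → T (P i) → T (any n P)
any⁺ n i<n p = <⇒<ᵇ (#-pos⁺ n i<n p)

any⁻ : ∀ n {P} → T (any n P) → ∃[ i ] i < n × T (P i)
any⁻ n p = #-pos⁻ n (<ᵇ⇒< 0 _ p)

#-below : ∀ {m n} P → m ≤ n → # n (λ w → (w <ᵇ m) ∧ P w) ≡ # m P
#-below {m} {n} P m≤n with m≤n⇒m<n∨m≡n m≤n
... | inj₂ refl = #-cong n λ i i<n → (λ p → proj₂ (∧⁻ p)) , ∧⁺ (<⇒<ᵇ i<n)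
#-below {m} {suc n} P m≤n | inj₁ (s≤s m≤n′) = trans
  (cong₂ _+_ (#-below P m≤n′)
    (cong bit (T-ext {(n <ᵇ m) ∧ P n} {false} (λ p → <⇒≱ (<ᵇ⇒< n m (proj₁ (∧⁻ p))) m≤n′) ⊥-elim)))
  (+-identityʳ _)

#-< : ∀ {m n} → m ≤ n → # n (λ w → w <ᵇ m) ≡ m
#-< {m} {n} m≤n = trans (#-cong n λ i _ → (λ p → ∧⁺ p tt) , (λ p → proj₁ (∧⁻ p)))
  (trans (#-below (λ _ → true) m≤n) (trans (∑-const m 1) (*-identityʳ m)))

#-mono-n : ∀ {m n} P → m ≤ n → # m P ≤ # n P
#-mono-n {m} {n} P m≤n = subst (_≤ # n P) (#-below P m≤n) (#-mono n λ i _ p → proj₂ (∧⁻ p))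

#-suc : ∀ {P v} → T (P v) → # (suc v) P ≡ suc (# v P)
#-suc {P} {v} p with P v
... | true = +-comm (# v P) 1

-- The i-th element of P, counting from 0: the number of v with at most i elements of P up to v.
nth : ℕ → (ℕ → Bool) → ℕ → ℕ
nth n P i = # n λ v → # n (λ w → (w <ᵇ suc v) ∧ P w) <ᵇ suc i

-- The count of `P` up to and including u is at most the rank of `v` exactly when u < v, since at
-- `v` itself it already exceeds that rank by one. So `nth` counts an initial segment of length `v`.
nth-rank : ∀ {n P v} → v < n → T (P v) → nth n P (# v P) ≡ v
nth-rank {n} {P} {v} v<n p = trans (#-cong n λ u u<n → to u u<n , from u u<n) (#-< (<⇒≤ v<n))
  where
  to : ∀ u → u < n → T (# n (λ w → (w <ᵇ suc u) ∧ P w) <ᵇ suc (# v P)) → T (u <ᵇ v)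
  to u u<n q rewrite #-below P u<n with u <? v
  ... | yes u<v = <⇒<ᵇ u<v
  ... | no  u≮v = ⊥-elim (<⇒≱ (<ᵇ⇒< _ _ q) (subst (_≤ # (suc u) P) (#-suc {P} {v} p) (#-mono-n P (s≤s (≮⇒≥ u≮v)))))
  from : ∀ u → u < n → T (u <ᵇ v) → T (# n (λ w → (w <ᵇ suc u) ∧ P w) <ᵇ suc (# v P))
  from u u<n q rewrite #-below P u<n = <⇒<ᵇ (s≤s (#-mono-n P (<ᵇ⇒< u v q)))

#-ivt : ∀ n {P i} → i < # n P → ∃[ v ] v < n × T (P v) × # v P ≡ i
#-ivt (suc n) {P} {i} i<# with i <? # n P
... | yes i<#n = let v , v<n , p = #-ivt n i<#n in v , m<n⇒m<1+n v<n , p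
... | no  i≮#n with P n in eq
...   | true  = n , ≤-refl , subst T (sym eq) tt
              , ≤-antisym (≮⇒≥ i≮#n) (≤-pred (subst (suc i ≤_) (+-comm (# n P) 1) i<#))
...   | false = ⊥-elim (i≮#n (subst (i <_) (+-identityʳ _) i<#))

nth-spec : ∀ n {P i} → i < # n P → nth n P i < n × T (P (nth n P i)) × # (nth n P i) P ≡ i
nth-spec n {P} i<# with v , v<n , p , refl ← #-ivt n i<# rewrite nth-rank {n} {P} {v} v<n p = v<n , p , refl

-- Change of summation variable between positions in a subset and its elements; it carries degree
-- sums and class sizes between the reduced graph and the original one.
∑-nth : ∀ n P (g : ℕ → ℕ) → ∑ (# n P) (λ i → g (nth n P i)) ≡ ∑ n (λ v → if P v then g v else 0)
∑-nth n P g = go n ≤-refl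
  where
  go : ∀ m → m ≤ n → ∑ (# m P) (λ i → g (nth n P i)) ≡ ∑ m (λ v → if P v then g v else 0)
  go zero    _   = refl
  go (suc m) m<n with T? (P m)
  ... | yes p rewrite #-suc {P} {m} p | nth-rank {n} {P} {m} m<n p | if-true {x = g m} {0} p =
    cong (_+ g m) (go m (<⇒≤ m<n))
  ... | no ¬p rewrite if-false {x = g m} {0} ¬p | if-false {x = 1} {0} ¬p | +-identityʳ (# m P) =
    trans (go m (<⇒≤ m<n)) (sym (+-identityʳ _))

-- Lets a quotient by 2 be computed by counting, since the term language has no division.
half-<ᵇ : ∀ i x → (suc (i + i) <ᵇ x) ≡ (i <ᵇ ⌊ x /2⌋)
half-<ᵇ zero    zero          = refl
half-<ᵇ (suc i) zero          = refl
half-<ᵇ zero    (suc zero)    = refl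
half-<ᵇ (suc i) (suc zero)    = refl
half-<ᵇ zero    (suc (suc x)) = refl
half-<ᵇ (suc i) (suc (suc x)) rewrite +-suc i i = half-<ᵇ i x

half-bounds : ∀ x → ⌊ x /2⌋ + ⌊ x /2⌋ ≤ x × x ≤ suc (⌊ x /2⌋ + ⌊ x /2⌋)
half-bounds zero          = z≤n , z≤n
half-bounds (suc zero)    = z≤n , ≤-refl
half-bounds (suc (suc x)) rewrite +-suc ⌊ x /2⌋ ⌊ x /2⌋ =
  let p , q = half-bounds x in s≤s (s≤s p) , s≤s (s≤s q)

double-cancel-≤ : ∀ {x y} → x + x ≤ y + y → x ≤ y
double-cancel-≤ p = ≮⇒≥ λ y<x → <⇒≱ (+-mono-< y<x y<x) p

-- Compiling a language of bounded sums to programs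

data Sort : Set where
  nat bool : Sort

Val : Sort → Set
Val nat  = ℕ
Val bool = Bool

code : ∀ σ → Val σ → ℕ
code nat  x = x
code bool b = bit b

-- Machine expressions offer only addition and truncated subtraction, so a primitive pairs its
-- meaning with such an expression and a proof that the codes agree.
record Op₁ (σ τ : Sort) : Set where
  field
    fun     : Val σ → Val τ
    expr    : Expr → Expr
    correct : ∀ e s x → eval e s ≡ code σ x → eval (expr e) s ≡ code τ (fun x)

record Op₂ (σ τ υ : Sort) : Set where
  field
    fun     : Val σ → Val τ → Val υ
    expr    : Expr → Expr → Expr
    correct : ∀ e f s x y → eval e s ≡ code σ x → eval f s ≡ code τ y →
              eval (expr e f) s ≡ code υ (fun x y)

-- `sum` always ranges below the order of the input graph, so every fixed term can be evaluated in
-- polynomial time. `bind` names a value, which is then computed only once.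
data Tm : Sort → ℕ → Set where
  var   : ∀ {m} → Fin m → Tm nat m
  lit   : ∀ {m} → ℕ → Tm nat m
  input : ∀ {m} → Fin 2 → Tm nat m → Tm nat m
  ap₁   : ∀ {m σ τ} → Op₁ σ τ → Tm σ m → Tm τ m
  ap₂   : ∀ {m σ τ υ} → Op₂ σ τ υ → Tm σ m → Tm τ m → Tm υ m
  sum   : ∀ {m} → Tm nat (suc m) → Tm nat m
  ite   : ∀ {m σ} → Tm bool m → Tm σ m → Tm σ m → Tm σ m
  bind  : ∀ {m σ} → Tm nat m → Tm σ (suc m) → Tm σ m

⟦_⟧ : ∀ {σ m} → Tm σ m → Instance → Vec ℕ m → Val σ
⟦ var x ⟧ I ρ       = lookup ρ x
⟦ lit c ⟧ I ρ       = c
⟦ input a t ⟧ I ρ   = encode I (toℕ a) (⟦ t ⟧ I ρ)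
⟦ ap₁ o t ⟧ I ρ     = Op₁.fun o (⟦ t ⟧ I ρ)
⟦ ap₂ o t u ⟧ I ρ   = Op₂.fun o (⟦ t ⟧ I ρ) (⟦ u ⟧ I ρ)
⟦ sum t ⟧ I ρ       = ∑ (order (G I)) λ i → ⟦ t ⟧ I (i ∷ ρ)
⟦ ite c t u ⟧ I ρ   = if ⟦ c ⟧ I ρ then ⟦ t ⟧ I ρ else ⟦ u ⟧ I ρ
⟦ bind t u ⟧ I ρ    = ⟦ u ⟧ I (⟦ t ⟧ I ρ ∷ ρ)

-- Array 4 is the environment (the innermost variable has the highest index),
-- array 5 a stack whose cell d receives the value of the term.
slot : ∀ {m} → Fin m → ℕ
slot {suc m} zero    = m
slot {suc m} (suc x) = slot x

compile : ∀ {σ m} → Tm σ m → ℕ → Program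
compile (var x) d       = 5 [ lit d ]≔ 4 [ lit (slot x) ]
compile (lit c) d       = 5 [ lit d ]≔ lit c
compile (input a t) d   = compile t d ⨟ 5 [ lit d ]≔ toℕ a [ 5 [ lit d ] ]
compile (ap₁ o t) d     = compile t d ⨟ 5 [ lit d ]≔ Op₁.expr o (5 [ lit d ])
compile (ap₂ o t u) d   =
  compile t d ⨟ compile u (suc d) ⨟
  5 [ lit d ]≔ Op₂.expr o (5 [ lit d ]) (5 [ lit (suc d) ])
compile {m = m} (sum t) d =
  5 [ lit d ]≔ lit 0 ⨟ 4 [ lit m ]≔ lit 0 ⨟
  While 0 [ lit 0 ] ⊖ 4 [ lit m ] Do
    (compile t (suc d) ⨟
     5 [ lit d ]≔ 5 [ lit d ] ⊕ 5 [ lit (suc d) ] ⨟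
     4 [ lit m ]≔ 4 [ lit m ] ⊕ lit 1)
compile (ite c t u) d   = compile c d ⨟ If 5 [ lit d ] Then compile t d Else compile u d
compile {m = m} (bind t u) d = compile t d ⨟ 4 [ lit m ]≔ 5 [ lit d ] ⨟ compile u d

-- The bracketing and the separate ones follow the step counts of the semantics. `ite` is charged
-- for both branches, as only an upper bound is wanted.
cost : ∀ {σ m} → Tm σ m → ℕ → ℕ
cost (var x) n     = 1
cost (lit c) n     = 1
cost (input a t) n = cost t n + 1
cost (ap₁ o t) n   = cost t n + 1
cost (ap₂ o t u) n = cost t n + (cost u n + 1)
cost (sum t) n     = 1 + (1 + (1 + n * suc (cost t n + (1 + 1))))
cost (ite c t u) n = cost c n + suc (cost t n + cost u n)
cost (bind t u) n  = cost t n + (1 + cost u n)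

-- Polynomial growth

Poly : (ℕ → ℕ) → Set
Poly f = ∃[ c ] ∃[ d ] ∀ n → f n ≤ c * suc n ^ d

poly-const : ∀ c → Poly (λ _ → c)
poly-const c = c , 0 , λ n → ≤-reflexive (sym (*-identityʳ c))

poly-id : Poly (λ n → n)
poly-id = 1 , 1 , λ n → ≤-trans (n≤1+n n) (≤-reflexive (sym (trans (*-identityˡ (suc n ^ 1)) (^-identityʳ (suc n)))))

-- The base `suc n` is never zero, so both exponents may be raised to their sum.
poly-+ : ∀ {f g} → Poly f → Poly g → Poly (λ n → f n + g n)
poly-+ {f} {g} (c , d , p) (c′ , d′ , p′) = c + c′ , d + d′ , λ n → begin
  f n + g n                                   ≤⟨ +-mono-≤ (p n) (p′ n) ⟩
  c * suc n ^ d + c′ * suc n ^ d′             ≤⟨ +-mono-≤ (*-monoʳ-≤ c (^-monoʳ-≤ (suc n) (m≤m+n d d′)))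
                                                          (*-monoʳ-≤ c′ (^-monoʳ-≤ (suc n) (m≤n+m d′ d))) ⟩
  c * suc n ^ (d + d′) + c′ * suc n ^ (d + d′) ≡⟨ *-distribʳ-+ (suc n ^ (d + d′)) c c′ ⟨
  (c + c′) * suc n ^ (d + d′)                 ∎
  where open ≤-Reasoning

poly-* : ∀ {f g} → Poly f → Poly g → Poly (λ n → f n * g n)
poly-* {f} {g} (c , d , p) (c′ , d′ , p′) = c * c′ , d + d′ , λ n → begin
  f n * g n                             ≤⟨ *-mono-≤ (p n) (p′ n) ⟩
  c * suc n ^ d * (c′ * suc n ^ d′)     ≡⟨ [m*n]*[o*p]≡[m*o]*[n*p] c (suc n ^ d) c′ (suc n ^ d′) ⟩
  c * c′ * (suc n ^ d * suc n ^ d′)     ≡⟨ cong (c * c′ *_) (^-distribˡ-+-* (suc n) d d′) ⟨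
  c * c′ * suc n ^ (d + d′)             ∎
  where open ≤-Reasoning

poly-suc : ∀ {f} → Poly f → Poly (λ n → suc (f n))
poly-suc = poly-+ (poly-const 1)

poly-cost : ∀ {σ m} (t : Tm σ m) → Poly (cost t)
poly-cost (var x)     = poly-const 1
poly-cost (lit c)     = poly-const 1
poly-cost (input a t) = poly-+ (poly-cost t) (poly-const 1)
poly-cost (ap₁ o t)   = poly-+ (poly-cost t) (poly-const 1)
poly-cost (ap₂ o t u) = poly-+ (poly-cost t) (poly-+ (poly-cost u) (poly-const 1))
poly-cost (sum t)     =
  poly-+ (poly-const 3) (poly-* poly-id (poly-suc (poly-+ (poly-cost t) (poly-const 2))))
poly-cost (ite c t u) = poly-+ (poly-cost c) (poly-suc (poly-+ (poly-cost t) (poly-cost u)))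
poly-cost (bind t u)  = poly-+ (poly-cost t) (poly-suc (poly-cost u))

-- Memory and the cells that a compiled term preserves

≡ᵇ-refl : ∀ i → (i ≡ᵇ i) ≡ true
≡ᵇ-refl zero    = refl
≡ᵇ-refl (suc i) = ≡ᵇ-refl i

>⇒≢ᵇ : ∀ {i j} → j < i → (i ≡ᵇ j) ≡ false
>⇒≢ᵇ {suc i} {zero}  _         = refl
>⇒≢ᵇ {suc i} {suc j} (s≤s j<i) = >⇒≢ᵇ j<i

updated : ∀ s a i x → (s [ a , i ↦ x ]) a i ≡ x
updated s a i x rewrite ≡ᵇ-refl a | ≡ᵇ-refl i = refl

-- What the surrounding computation still relies on while a term with m variables runs at stack
-- depth d: the bound variables, the pending intermediate results, and the input and output arrays.
Safe : ℕ → ℕ → ℕ → ℕ → Set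
Safe m d 4 j = j < m
Safe m d 5 j = j < d
Safe m d _ j = ⊤

Safe-mono : ∀ {m m′ d d′} → m ≤ m′ → d ≤ d′ → ∀ b j → Safe m d b j → Safe m′ d′ b j
Safe-mono p q 0 j s = tt
Safe-mono p q 1 j s = tt
Safe-mono p q 2 j s = tt
Safe-mono p q 3 j s = tt
Safe-mono p q 4 j s = <-≤-trans s p
Safe-mono p q 5 j s = <-≤-trans s q
Safe-mono p q (suc (suc (suc (suc (suc (suc b)))))) j s = tt

Frame : ℕ → ℕ → State → State → Set
Frame m d s s′ = ∀ b j → Safe m d b j → s′ b j ≡ s b j

frame-trans : ∀ {m d s s′ s″} → Frame m d s s′ → Frame m d s′ s″ → Frame m d s s″
frame-trans f g b j p = trans (g b j p) (f b j p)

frame-mono : ∀ {m m′ d d′ s s′} → m ≤ m′ → d ≤ d′ → Frame m′ d′ s s′ → Frame m d s s′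
frame-mono p q f b j x = f b j (Safe-mono p q b j x)

push : ∀ m d s x → Frame m d s (s [ 5 , d ↦ x ])
push m d s x 0 j p = refl
push m d s x 1 j p = refl
push m d s x 2 j p = refl
push m d s x 3 j p = refl
push m d s x 4 j p = refl
push m d s x 5 j p rewrite >⇒≢ᵇ p = refl
push m d s x (suc (suc (suc (suc (suc (suc b)))))) j p = refl

assign-var : ∀ m d s x → Frame m d s (s [ 4 , m ↦ x ])
assign-var m d s x 0 j p = refl
assign-var m d s x 1 j p = refl
assign-var m d s x 2 j p = refl
assign-var m d s x 3 j p = refl
assign-var m d s x 4 j p rewrite >⇒≢ᵇ p = refl
assign-var m d s x 5 j p = refl
assign-var m d s x (suc (suc (suc (suc (suc (suc b)))))) j p = refl

Env : ∀ {m} → State → Vec ℕ m → Set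
Env             s []      = ⊤
Env {m = suc m} s (x ∷ ρ) = s 4 m ≡ x × Env s ρ

Env-frame : ∀ {m d s s′} (ρ : Vec ℕ m) → Frame m d s s′ → Env s ρ → Env s′ ρ
Env-frame []      f e = tt
Env-frame {suc m} (x ∷ ρ) f (p , e) =
  trans (f 4 m ≤-refl) p , Env-frame ρ (frame-mono (n≤1+n _) ≤-refl f) e

Env-lookup : ∀ {m s} (ρ : Vec ℕ m) x → Env s ρ → s 4 (slot x) ≡ lookup ρ x
Env-lookup (_ ∷ _) zero    (p , _) = p
Env-lookup (_ ∷ ρ) (suc x) (_ , e) = Env-lookup ρ x e

Holds : Instance → State → Set
Holds I s = ∀ (a : Fin 2) j → s (toℕ a) j ≡ encode I (toℕ a) j

Holds-frame : ∀ {I m d s s′} → Frame m d s s′ → Holds I s → Holds I s′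
Holds-frame f h zero       j = trans (f 0 j tt) (h zero j)
Holds-frame f h (suc zero) j = trans (f 1 j tt) (h (suc zero) j)

record Ready (I : Instance) {m} (ρ : Vec ℕ m) (s : State) : Set where
  constructor ready
  field
    holds : Holds I s
    env   : Env s ρ

advance : ∀ {I m d s s′} {ρ : Vec ℕ m} → Frame m d s s′ → Ready I ρ s → Ready I ρ s′
advance {ρ = ρ} f (ready h e) = ready (Holds-frame f h) (Env-frame ρ f e)

bind-var : ∀ {I m s x} {ρ : Vec ℕ m} → s 4 m ≡ x → Ready I ρ s → Ready I (x ∷ ρ) s
bind-var p (ready h e) = ready h (p , e)

record Computes (m d : ℕ) (p : Program) (s : State) (v c : ℕ) : Set where
  field
    steps : ℕ
    final : State
    run   : ⟨ p , s ⟩⇓[ steps ] final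
    value : final 5 d ≡ v
    frame : Frame m d s final
    time  : steps ≤ c

open Computes

-- Induction on the term, for every start state, because a term runs on memory that other terms have
-- used. The frame condition drives the induction: a second operand runs at depth `suc d` and so
-- preserves the first result, and a loop body preserves the accumulator and the counter.
compile-correct : ∀ {σ m} (t : Tm σ m) d {I s} {ρ : Vec ℕ m} → Ready I ρ s →
                  Computes m d (compile t d) s (code σ (⟦ t ⟧ I ρ)) (cost t (order (G I)))

module Loop {m} (t : Tm nat (suc m)) (d : ℕ) (I : Instance) (ρ : Vec ℕ m) where

  n : ℕ
  n = order (G I)

  f : ℕ → ℕ
  f i = ⟦ t ⟧ I (i ∷ ρ)

  body : Program
  body = compile t (suc d) ⨟
         5 [ lit d ]≔ 5 [ lit d ] ⊕ 5 [ lit (suc d) ] ⨟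
         4 [ lit m ]≔ 4 [ lit m ] ⊕ lit 1

  guard : Expr
  guard = 0 [ lit 0 ] ⊖ 4 [ lit m ]

  -- Induction on the number `j` of rounds still to come; `i` rounds are done, and the counter
  -- doubles as the variable bound by `sum`.
  loop : ∀ j i s → i + j ≡ n → Ready I ρ s → s 4 m ≡ i → s 5 d ≡ ∑ i f →
         Computes m d (While guard Do body) s (∑ n f)
                  (1 + j * suc (cost t n + (1 + 1)))
  loop zero i s i≡n rdy var≡ acc≡ = record
    { run   = exit (trans (cong₂ _∸_ (Ready.holds rdy zero 0) var≡) (m≤n⇒m∸n≡0 (≤-reflexive (sym n≡i))))
    ; value = trans acc≡ (cong (λ x → ∑ x f) n≡i)
    ; frame = λ _ _ _ → refl
    ; time  = ≤-refl
    }
    where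
    n≡i : i ≡ n
    n≡i = trans (sym (+-identityʳ i)) i≡n
  loop (suc j) i s eq rdy var≡ acc≡ = record
    { run   = iterate guard≢0 (seq (run C) (seq assign assign)) (run L)
    ; value = value L
    ; frame = frame-trans fr (frame L)
    ; time  = ≤-trans (s≤s (+-mono-≤ (+-monoˡ-≤ 2 (time C)) (time L))) (≤-reflexive arith)
    }
    where
    C = compile-correct t (suc d) (bind-var var≡ rdy)
    s₁ = final C
    s₂ = s₁ [ 5 , d ↦ s₁ 5 d + s₁ 5 (suc d) ]
    s₃ = s₂ [ 4 , m ↦ s₂ 4 m + 1 ]
    fr : Frame m d s s₃
    fr = frame-trans (frame-trans (frame-mono (n≤1+n m) (n≤1+n d) (frame C)) (push m d s₁ _))
                     (assign-var m d s₂ _)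
    guard≢0 : eval guard s ≢ 0
    guard≢0 z = <⇒≱ (≤-trans (m<m+n i (s≤s z≤n)) (≤-reflexive eq))
      (m∸n≡0⇒m≤n (trans (sym (cong₂ _∸_ (Ready.holds rdy zero 0) var≡)) z))
    var′ : s₃ 4 m ≡ suc i
    var′ = trans (updated s₂ 4 m _)
             (trans (cong (_+ 1) (trans (frame C 4 m ≤-refl) var≡)) (+-comm i 1))
    acc′ : s₃ 5 d ≡ ∑ (suc i) f
    acc′ = trans (updated s₁ 5 d _) (cong₂ _+_ (trans (frame C 5 d ≤-refl) acc≡) (value C))
    L = loop j (suc i) s₃ (trans (sym (+-suc i j)) eq) (advance fr rdy) var′ acc′
    arith : suc (cost t n + 2 + (1 + j * suc (cost t n + (1 + 1)))) ≡ 1 + suc j * suc (cost t n + (1 + 1))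
    arith = cong suc (+-suc (cost t n + 2) (j * suc (cost t n + 2)))

compile-correct (var x) d {s = s} {ρ} rdy = record
  { run = assign ; value = trans (updated s 5 d _) (Env-lookup ρ x (Ready.env rdy))
  ; frame = push _ d s _ ; time = ≤-refl }
compile-correct (lit c) d {s = s} rdy = record
  { run = assign ; value = updated s 5 d c ; frame = push _ d s c ; time = ≤-refl }
compile-correct (input a t) d {I = I} rdy = record
  { run   = seq (run C) assign
  ; value = trans (updated (final C) 5 d _)
              (trans (Ready.holds (advance (frame C) rdy) a _) (cong (encode I (toℕ a)) (value C)))
  ; frame = frame-trans (frame C) (push _ d (final C) _)
  ; time  = +-monoˡ-≤ 1 (time C)
  }
  where C = compile-correct t d rdy
compile-correct (ap₁ o t) d rdy = record
  { run   = seq (run C) assign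
  ; value = trans (updated (final C) 5 d _) (Op₁.correct o (5 [ lit d ]) _ _ (value C))
  ; frame = frame-trans (frame C) (push _ d (final C) _)
  ; time  = +-monoˡ-≤ 1 (time C)
  }
  where C = compile-correct t d rdy
compile-correct (ap₂ o t u) d rdy = record
  { run   = seq (run C) (seq (run D) assign)
  ; value = trans (updated (final D) 5 d _)
              (Op₂.correct o (5 [ lit d ]) (5 [ lit (suc d) ]) _ _ _
                 (trans (frame D 5 d ≤-refl) (value C)) (value D))
  ; frame = frame-trans (frame-trans (frame C) (frame-mono ≤-refl (n≤1+n d) (frame D))) (push _ d (final D) _)
  ; time  = +-mono-≤ (time C) (+-monoˡ-≤ 1 (time D))
  }
  where
  C = compile-correct t d rdy
  D = compile-correct u (suc d) (advance (frame C) rdy)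
compile-correct {m = m} (sum t) d {I} {s} {ρ} rdy = record
  { run   = seq assign (seq assign (run L))
  ; value = value L
  ; frame = frame-trans fr (frame L)
  ; time  = s≤s (s≤s (time L))
  }
  where
  s₁ = s [ 5 , d ↦ 0 ]
  s₂ = s₁ [ 4 , m ↦ 0 ]
  fr : Frame m d s s₂
  fr = frame-trans (push m d s 0) (assign-var m d s₁ 0)
  L = Loop.loop t d I ρ (order (G I)) 0 s₂ refl (advance fr rdy) (updated s₁ 4 m 0) (updated s 5 d 0)
compile-correct {σ} (ite c t u) d {I} {ρ = ρ} rdy
  with ⟦ c ⟧ I ρ | compile-correct c d rdy
... | true | C = record
  { run   = seq (run C) (then′ (λ z → 1+n≢0 (trans (sym (value C)) z)) (run D))
  ; value = value D
  ; frame = frame-trans (frame C) (frame D)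
  ; time  = +-mono-≤ (time C) (s≤s (≤-trans (time D) (m≤m+n _ _)))
  }
  where D = compile-correct t d (advance (frame C) rdy)
... | false | C = record
  { run   = seq (run C) (else′ (value C) (run D))
  ; value = value D
  ; frame = frame-trans (frame C) (frame D)
  ; time  = +-mono-≤ (time C) (s≤s (≤-trans (time D) (m≤n+m _ (cost t _))))
  }
  where D = compile-correct u d (advance (frame C) rdy)
compile-correct {m = m} (bind t u) d rdy = record
  { run   = seq (run C) (seq assign (run D))
  ; value = value D
  ; frame = frame-trans fr (frame-mono (n≤1+n m) ≤-refl (frame D))
  ; time  = +-mono-≤ (time C) (s≤s (time D))
  }
  where
  C = compile-correct t d rdy
  fr = frame-trans (frame C) (assign-var m d (final C) (final C 5 d))
  D = compile-correct u d (bind-var (trans (updated (final C) 4 m _) (value C)) (advance fr rdy))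

-- Writing the output instance

index< : ∀ {m n i j} → m ≤ n → i < m → j < m → m * i + j < n * n
index< {m} {n} {i} {j} m≤n i<m j<m = begin-strict
  m * i + j  <⟨ +-monoʳ-< (m * i) j<m ⟩
  m * i + m  ≡⟨ +-comm (m * i) m ⟩
  m + m * i  ≡⟨ *-suc m i ⟨
  m * suc i  ≤⟨ *-mono-≤ m≤n (≤-trans i<m m≤n) ⟩
  n * n      ∎
  where open ≤-Reasoning

square : Tm nat 0
square = sum (input zero (lit 0))

module Writer (tn tk : Tm nat 0) (ta : Tm bool 1) where

  -- Cell 0 of array 4 is at once the loop counter and the one variable of `ta`. The loop runs up to
  -- the square of the input order, which `square` obtains by repeated addition. This covers the
  -- output matrix when the output is no larger than the input; surplus entries of array 3 are
  -- scratch.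
  body loop program : Program
  body = compile ta 0 ⨟
         3 [ 4 [ lit 0 ] ]≔ 5 [ lit 0 ] ⨟
         4 [ lit 0 ]≔ 4 [ lit 0 ] ⊕ lit 1
  loop = While 2 [ lit 2 ] ⊖ 4 [ lit 0 ] Do body
  program =
    compile tn 0 ⨟ 2 [ lit 0 ]≔ 5 [ lit 0 ] ⨟
    compile tk 0 ⨟ 2 [ lit 1 ]≔ 5 [ lit 0 ] ⨟
    compile square 0 ⨟ 2 [ lit 2 ]≔ 5 [ lit 0 ] ⨟
    4 [ lit 0 ]≔ lit 0 ⨟ loop

  loopCost programCost : ℕ → ℕ → ℕ
  loopCost n j = 1 + j * suc (cost ta n + (1 + 1))
  programCost n N =
    cost tn n + (1 + (cost tk n + (1 + (cost square n + (1 + (1 + loopCost n N))))))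

  module Run (I : Instance) where

    n : ℕ
    n = order (G I)

    entry : ℕ → ℕ
    entry p = bit (⟦ ta ⟧ I (p ∷ []))

    record Written (i : ℕ) (s : State) : Set where
      field
        holds   : Holds I s
        out-n   : s 2 0 ≡ ⟦ tn ⟧ I []
        out-k   : s 2 1 ≡ ⟦ tk ⟧ I []
        limit   : s 2 2 ≡ n * n
        counter : s 4 0 ≡ i
        entries : ∀ q → q < i → s 3 q ≡ entry q

    open Written

    write-loop : ∀ j i s → i + j ≡ n * n → Written i s →
      ∃[ t ] ∃[ s′ ] ⟨ loop , s ⟩⇓[ t ] s′ × Written (n * n) s′ × t ≤ loopCost n j
    write-loop zero i s eq w =
      1 , s , exit (trans (cong₂ _∸_ (limit w) (counter w)) (m≤n⇒m∸n≡0 (≤-reflexive (sym i≡))))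
      , subst (λ i → Written i s) i≡ w , ≤-refl
      where
      i≡ : i ≡ n * n
      i≡ = trans (sym (+-identityʳ i)) eq
    write-loop (suc j) i s eq w =
      let t′ , s′ , r′ , w″ , t′≤ = write-loop j (suc i) s₃ (trans (sym (+-suc i j)) eq) w′
      in _ , s′ , iterate guard≢0 (seq (run C) (seq assign assign)) r′ , w″
       , ≤-trans (s≤s (+-mono-≤ (+-monoˡ-≤ 2 (time C)) t′≤))
                 (≤-reflexive (cong suc (+-suc (cost ta n + 2) (j * suc (cost ta n + 2)))))
      where
      C = compile-correct ta 0 {I} {s} {i ∷ []} (ready (holds w) (counter w , tt))
      s₁ = final C
      s₂ = s₁ [ 3 , s₁ 4 0 ↦ s₁ 5 0 ]
      s₃ = s₂ [ 4 , 0 ↦ s₂ 4 0 + 1 ]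
      guard≢0 : s 2 2 ∸ s 4 0 ≢ 0
      guard≢0 z = <⇒≱ (≤-trans (m<m+n i (s≤s z≤n)) (≤-reflexive eq))
        (m∸n≡0⇒m≤n (trans (sym (cong₂ _∸_ (limit w) (counter w))) z))
      counter₁ : s₁ 4 0 ≡ i
      counter₁ = trans (frame C 4 0 (s≤s z≤n)) (counter w)
      holds₁ : Holds I s₁
      holds₁ = Holds-frame (frame C) (holds w)
      entries′ : ∀ q → q < suc i → s₃ 3 q ≡ entry q
      entries′ q q<1+i with m≤n⇒m<n∨m≡n (≤-pred q<1+i)
      ... | inj₁ q<i rewrite counter₁ | >⇒≢ᵇ q<i = trans (frame C 3 q tt) (entries w q q<i)
      ... | inj₂ refl rewrite counter₁ | ≡ᵇ-refl q = value C
      w′ : Written (suc i) s₃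
      w′ = record
        { holds   = λ { zero j → holds₁ zero j ; (suc zero) j → holds₁ (suc zero) j }
        ; out-n   = trans (frame C 2 0 tt) (out-n w)
        ; out-k   = trans (frame C 2 1 tt) (out-k w)
        ; limit   = trans (frame C 2 2 tt) (limit w)
        ; counter = trans (cong (_+ 1) counter₁) (+-comm i 1)
        ; entries = entries′
        }

    runs : ∃[ t ] ∃[ s ] ⟨ program , encode I ⟩⇓[ t ] s × Written (n * n) s × t ≤ programCost n (n * n)
    runs =
      let t , s , r , w , t≤ = write-loop (n * n) 0 s₇ refl w₀
      in _ , s
       , seq (run C₁) (seq assign (seq (run C₂) (seq assign (seq (run C₃) (seq assign (seq assign r))))))
       , w
       , +-mono-≤ (time C₁) (s≤s (+-mono-≤ (time C₂) (s≤s (+-mono-≤ (time C₃) (s≤s (s≤s t≤))))))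
      where
      holds₀ : Holds I (encode I)
      holds₀ a j = refl
      C₁ = compile-correct tn 0 {I} {encode I} (ready holds₀ tt)
      s₁ = final C₁
      s₂ = s₁ [ 2 , 0 ↦ s₁ 5 0 ]
      holds₂ : Holds I s₂
      holds₂ zero       j = Holds-frame (frame C₁) holds₀ zero j
      holds₂ (suc zero) j = Holds-frame (frame C₁) holds₀ (suc zero) j
      C₂ = compile-correct tk 0 {I} {s₂} (ready holds₂ tt)
      s₃ = final C₂
      s₄ = s₃ [ 2 , 1 ↦ s₃ 5 0 ]
      holds₄ : Holds I s₄
      holds₄ zero       j = Holds-frame (frame C₂) holds₂ zero j
      holds₄ (suc zero) j = Holds-frame (frame C₂) holds₂ (suc zero) j
      C₃ = compile-correct square 0 {I} {s₄} (ready holds₄ tt)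
      s₅ = final C₃
      s₆ = s₅ [ 2 , 2 ↦ s₅ 5 0 ]
      s₇ = s₆ [ 4 , 0 ↦ 0 ]
      w₀ : Written 0 s₇
      w₀ = record
        { holds   = λ { zero j → Holds-frame (frame C₃) holds₄ zero j
                      ; (suc zero) j → Holds-frame (frame C₃) holds₄ (suc zero) j }
        ; out-n   = trans (frame C₃ 2 0 tt) (trans (frame C₂ 2 0 tt) (value C₁))
        ; out-k   = trans (frame C₃ 2 1 tt) (value C₂)
        ; limit   = trans (value C₃) (∑-const n n)
        ; counter = refl
        ; entries = λ _ ()
        }

  programCost-poly : Poly (λ n → programCost n (n * n))
  programCost-poly =
    poly-+ (poly-cost tn) (poly-suc (poly-+ (poly-cost tk) (poly-suc (poly-+ (poly-cost square)
      (poly-suc (poly-suc (poly-suc (poly-* (poly-* poly-id poly-id)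
        (poly-suc (poly-+ (poly-cost ta) (poly-const 2)))))))))))

  polynomial-time : ∀ (φ : Instance → Instance) →
    (∀ I → order (G (φ I)) ≤ order (G I)) →
    (∀ I → ⟦ tn ⟧ I [] ≡ order (G (φ I))) →
    (∀ I → ⟦ tk ⟧ I [] ≡ k (φ I)) →
    (∀ I u v → ⟦ ta ⟧ I (order (G (φ I)) * toℕ u + toℕ v ∷ []) ≡ adj (G (φ I)) u v) →
    PolynomialTime φ
  polynomial-time φ n′≤n n≡ k≡ a≡ =
    let c , d , p = programCost-poly in
    program , c , d , λ I →
    let t , s , r , w , t≤ = Run.runs I in
    t , s , r
    , ( trans (Run.Written.out-n w) (n≡ I)
      , trans (Run.Written.out-k w) (k≡ I)
      , λ u v → trans (Run.Written.entries w _ (index< (n′≤n I) (toℕ<n u) (toℕ<n v))) (cong bit (a≡ I u v)))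
    , ≤-trans t≤ (≤-trans (p (order (G I)))
        (≤-trans (*-monoʳ-≤ c (^-monoˡ-≤ d (size (order (G I)) _))) (m≤m+n _ c)))
    where
    -- The base of the polynomial bound is at most the input length, whose last summand is at least
    -- 1; this settles n = 0 too.
    size : ∀ n l → suc n ≤ n * n + suc l
    size zero    l = s≤s z≤n
    size (suc n) l = ≤-trans (s≤s (m≤m*n (suc n) (suc n)))
                       (≤-trans (≤-reflexive (+-comm 1 (suc n * suc n))) (+-monoʳ-≤ (suc n * suc n) (s≤s z≤n)))

-- Cliques of equal size as equivalence relations

Rel : Set
Rel = ℕ → ℕ → Bool

near : Rel → Rel
near a u v = (u ≡ᵇ v) ∨ a u v

degree : ℕ → Rel → ℕ → ℕ
degree n a u = # n (a u)

-- Restricting the equivalence relation to a vertex set `W` lets parts be dropped under the original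
-- vertex names, before any renumbering.
record Partition (n : ℕ) (a : Rel) (W : ℕ → Bool) (r : ℕ) : Set where
  field
    R      : Rel
    inside : ∀ {u v} → T (R u v) → u < n × T (W u)
    refl′  : ∀ {u} → u < n → T (W u) → T (R u u)
    sym′   : ∀ {u v} → T (R u v) → T (R v u)
    trans′ : ∀ {u v w} → T (R u v) → T (R v w) → T (R u w)
    close  : ∀ {u v} → T (R u v) → T (near a u v)
    size   : ∀ {u} → u < n → T (W u) → # n (R u) ≡ suc r

does⁻ : ∀ {P : Set} (d : Dec P) → T (does d) → P
does⁻ (yes p) _ = p

does⁺ : ∀ {P : Set} (d : Dec P) → P → T (does d)
does⁺ (yes _) _ = tt
does⁺ (no ¬p) p = ⊥-elim (¬p p)

near⁻ : ∀ {a u v} → T (near a u v) → u ≢ v → T (a u v)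
near⁻ {a} {u} {v} p u≢v with ∨⁻ {u ≡ᵇ v} p
... | inj₁ e = ⊥-elim (u≢v (≡ᵇ⇒≡ u v e))
... | inj₂ q = q

near-refl : ∀ a u → T (near a u u)
near-refl a u = ∨⁺₁ (≡⇒≡ᵇ u u refl)

ext : ∀ {n} → (Fin n → Fin n → Bool) → Rel
ext {n} f u v with u <? n | v <? n
... | yes u<n | yes v<n = f (fromℕ< u<n) (fromℕ< v<n)
... | _       | _       = false

ext⁻ : ∀ {n} {f : Fin n → Fin n → Bool} {u v} → T (ext f u v) →
       ∃[ x ] ∃[ y ] toℕ x ≡ u × toℕ y ≡ v × T (f x y)
ext⁻ {n} {f} {u} {v} p with u <? n | v <? n
... | yes u<n | yes v<n = _ , _ , toℕ-fromℕ< u<n , toℕ-fromℕ< v<n , p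
... | yes _   | no _    = ⊥-elim p
... | no _    | _       = ⊥-elim p

ext-toℕ : ∀ {n} (f : Fin n → Fin n → Bool) x y → ext f (toℕ x) (toℕ y) ≡ f x y
ext-toℕ {n} f x y with toℕ x <? n | toℕ y <? n
... | yes p | yes q = cong₂ f (fromℕ<-toℕ x p) (fromℕ<-toℕ y q)
... | yes _ | no ¬q = ⊥-elim (¬q (toℕ<n y))
... | no ¬p | _     = ⊥-elim (¬p (toℕ<n x))

ext⁺ : ∀ {n} {f : Fin n → Fin n → Bool} x y → T (f x y) → T (ext f (toℕ x) (toℕ y))
ext⁺ {f = f} x y = subst T (sym (ext-toℕ f x y))

length-filter-tabulate : ∀ n {A : Set} {P : A → Set} (P? : Decidable P) (f : Fin n → A) (p : ℕ → Bool) →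
  (∀ i → does (P? (f i)) ≡ p (toℕ i)) → length (filter P? (tabulate f)) ≡ # n p
length-filter-tabulate zero    P? f p eq = refl
length-filter-tabulate (suc n) P? f p eq with does (P? (f zero)) | eq zero
... | true  | e = trans (cong suc (length-filter-tabulate n P? (f ∘ suc) (p ∘ suc) (eq ∘ suc)))
                    (sym (trans (∑-suc n (bit ∘ p)) (cong (λ b → bit b + # n (p ∘ suc)) (sym e))))
... | false | e = trans (length-filter-tabulate n P? (f ∘ suc) (p ∘ suc) (eq ∘ suc))
                    (sym (trans (∑-suc n (bit ∘ p)) (cong (λ b → bit b + # n (p ∘ suc)) (sym e))))

length-filter-product : ∀ m n {A : Set} {P : A × Fin n → Set} (P? : Decidable P) (f : Fin m → A) (p : Rel) →
  (∀ i j → does (P? (f i , j)) ≡ p (toℕ i) (toℕ j)) →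
  length (filter P? (cartesianProduct (tabulate f) (allFin n))) ≡ ∑ m (λ u → # n (p u))
length-filter-product zero    n P? f p eq = refl
length-filter-product (suc m) n P? f p eq = begin
  length (filter P? (map (f zero ,_) (allFin n) ++ rest))
    ≡⟨ cong length (filter-++ P? (map (f zero ,_) (allFin n)) rest) ⟩
  length (filter P? (map (f zero ,_) (allFin n)) ++ filter P? rest)
    ≡⟨ length-++ (filter P? (map (f zero ,_) (allFin n))) ⟩
  length (filter P? (map (f zero ,_) (allFin n))) + length (filter P? rest)
    ≡⟨ cong₂ _+_ (trans (cong (length ∘ filter P?) (map-tabulate (λ i → i) (f zero ,_)))
                        (length-filter-tabulate n P? (f zero ,_) (p 0) (eq zero)))
                 (length-filter-product m n P? (f ∘ suc) (p ∘ suc) (eq ∘ suc)) ⟩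
  # n (p 0) + ∑ m (λ u → # n (p (suc u)))
    ≡⟨ ∑-suc m (λ u → # n (p u)) ⟨
  ∑ (suc m) (λ u → # n (p u)) ∎
  where
  open ≡-Reasoning
  rest = cartesianProduct (tabulate (f ∘ suc)) (allFin n)

-- The cardinality counts each edge from its smaller end. An ordered pair is oriented one way or the
-- other, and exchanging the two sums turns the second orientation into the first.
handshake : ∀ {n} (F : EdgeSet n) (f : Rel) → (∀ x y → has F x y ≡ f (toℕ x) (toℕ y)) →
            (∀ u v → f u v ≡ f v u) → (∀ u → ¬ T (f u u)) →
            ∑ n (degree n f) ≡ ∣ F ∣ₑ + ∣ F ∣ₑ
handshake {n} F f F≡f f-sym f-irr = begin
  ∑ n (degree n f)
    ≡⟨ ∑-cong n (λ u _ → trans (∑-cong n λ v _ → orient u v) (∑-+ n _ _)) ⟩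
  ∑ n (λ u → # n (λ v → (u <ᵇ v) ∧ f u v) + # n (λ v → (v <ᵇ u) ∧ f v u))
    ≡⟨ ∑-+ n _ _ ⟩
  ∑ n (λ u → # n (λ v → (u <ᵇ v) ∧ f u v)) + ∑ n (λ u → # n (λ v → (v <ᵇ u) ∧ f v u))
    ≡⟨ cong₂ _+_ (sym card) (trans (∑-swap n n (λ u v → bit ((v <ᵇ u) ∧ f v u))) (sym card)) ⟩
  ∣ F ∣ₑ + ∣ F ∣ₑ ∎
  where
  open ≡-Reasoning
  card : ∣ F ∣ₑ ≡ ∑ n (λ u → # n (λ v → (u <ᵇ v) ∧ f u v))
  card = length-filter-product n n _ (λ i → i) (λ u v → (u <ᵇ v) ∧ f u v)
           (λ i j → cong ((toℕ i <ᵇ toℕ j) ∧_) (F≡f i j))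
  orient : ∀ u v → bit (f u v) ≡ bit ((u <ᵇ v) ∧ f u v) + bit ((v <ᵇ u) ∧ f v u)
  orient u v rewrite f-sym v u with T? (f u v)
  ... | no ¬p rewrite T-ext {f u v} {false} ¬p ⊥-elim = both u v
    where
    both : ∀ u v → 0 ≡ bit ((u <ᵇ v) ∧ false) + bit ((v <ᵇ u) ∧ false)
    both u v with u <ᵇ v | v <ᵇ u
    ... | true  | true  = refl
    ... | true  | false = refl
    ... | false | true  = refl
    ... | false | false = refl
  ... | yes p rewrite T-ext {f u v} {true} _ (λ _ → p) = one u v λ { refl → f-irr u p }
    where
    one : ∀ u v → u ≢ v → 1 ≡ bit ((u <ᵇ v) ∧ true) + bit ((v <ᵇ u) ∧ true)
    one zero    zero    u≢v = ⊥-elim (u≢v refl)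
    one zero    (suc v) u≢v = refl
    one (suc u) zero    u≢v = refl
    one (suc u) (suc v) u≢v = one u v (u≢v ∘ cong suc)

-- With `R` the class of `u` and `f` the deleted edges at `u`, the surviving edges at `u` lead
-- exactly to the other r members of the class.
degree-split : ∀ n {a f R : ℕ → Bool} {u r} → u < n → T (R u) → # n R ≡ suc r →
  (∀ v → v < n → T (f v) → T (a v)) →
  (∀ v → v < n → T (a v) → ¬ T (f v) → T (R v) × v ≢ u) →
  (∀ v → v < n → T (R v) → v ≢ u → T (a v) × ¬ T (f v)) →
  # n a ≡ # n f + r
degree-split n {a} {f} {R} {u} {r} u<n Ru size f⊆a to from = begin
  # n a
    ≡⟨ #-split n a f ⟩
  # n (λ v → a v ∧ f v) + # n (λ v → a v ∧ not (f v))
    ≡⟨ cong₂ _+_ (#-cong n λ v v<n → (λ p → proj₂ (∧⁻ p)) , λ p → ∧⁺ (f⊆a v v<n p) p)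
                 (suc-injective (trans (sym R≡) size)) ⟩
  # n f + r ∎
  where
  open ≡-Reasoning
  R≡ : # n R ≡ suc (# n (λ v → a v ∧ not (f v)))
  R≡ = trans (#-split n R (_≡ᵇ u)) (cong₂ _+_
    (trans (#-cong n λ v _ → (λ p → proj₂ (∧⁻ p)) , λ p → ∧⁺ (subst (T ∘ R) (sym (≡ᵇ⇒≡ v u p)) Ru) p)
           (#-single n u u<n))
    (#-cong n λ v v<n →
      (λ p → let Rv , v≢u = ∧⁻ {R v} p
                 av , ¬fv = from v v<n Rv (λ e → not⁻ v≢u (≡⇒≡ᵇ v u e)) in ∧⁺ av (not⁺ ¬fv)) ,
      (λ p → let av , ¬fv = ∧⁻ {a v} p
                 Rv , v≢u = to v v<n av (not⁻ ¬fv) in ∧⁺ Rv (not⁺ λ e → v≢u (≡ᵇ⇒≡ v u e)))))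

∑-degree : ∀ n (a f : Rel) r → (∀ u → u < n → degree n a u ≡ degree n f u + r) →
           ∑ n (degree n a) ≡ ∑ n (degree n f) + n * r
∑-degree n a f r p = trans (∑-cong n p) (trans (∑-+ n (degree n f) (λ _ → r)) (cong (∑ n (degree n f) +_) (∑-const n r)))

all : ℕ → Bool
all _ = true

-- The degree sum is n r plus twice the number of deletions, so `budget` says that at most k edges
-- are deleted; the edge set itself has disappeared.
record Solution (n : ℕ) (a : Rel) (k : ℕ) : Set where
  constructor solution
  field
    r      : ℕ
    parts  : Partition n a all r
    budget : ∑ n (degree n a) ≤ k + k + n * r

-- Between edge deletion sets and partitions

module _ (I : Instance) (a : Rel) (adj≡a : ∀ x y → adj (G I) x y ≡ a (toℕ x) (toℕ y)) where

  private
    n = order (G I)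

  UCED⇒Solution : UCED I → Solution n a (k I)
  UCED⇒Solution (F , F⊆E , F≤k , uc) = go n refl
    where
    open UniformCluster uc renaming (size to s)
    f R : Rel
    f = ext (has F)
    same : Fin n → Fin n → Bool
    same x y = does (clique y ≟ clique x)
    R = ext same
    same⁻ : ∀ {x y} → T (same x y) → clique y ≡ clique x
    same⁻ {x} {y} = does⁻ (clique y ≟ clique x)
    same⁺ : ∀ {x y} → clique y ≡ clique x → T (same x y)
    same⁺ {x} {y} = does⁺ (clique y ≟ clique x)
    size-R : ∀ x → # n (R (toℕ x)) ≡ s
    size-R x = trans (sym (length-filter-tabulate n (λ v → clique v ≟ clique x) (λ i → i) (R (toℕ x))
                             (λ y → sym (ext-toℕ same x y)))) (uniform (clique x))
    lift : ∀ {u} → u < n → ∃[ x ] toℕ {n} x ≡ u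
    lift u<n = fromℕ< u<n , toℕ-fromℕ< u<n
    build : ∀ {r} → s ≡ suc r → Solution n a (k I)
    build {r} s≡ = record
      { r = r
      ; parts = record
        { R      = R
        ; inside = λ p → let x , y , x≡ , y≡ , q = ext⁻ {f = same} p in subst (_< n) x≡ (toℕ<n x) , tt
        ; refl′  = λ u<n _ → refl-R u<n
        ; sym′   = λ p → case-sym (ext⁻ {f = same} p)
        ; trans′ = λ p q → case-trans (ext⁻ {f = same} p) (ext⁻ {f = same} q)
        ; close  = λ p → case-close (ext⁻ {f = same} p)
        ; size   = λ u<n _ → size-u u<n
        }
      ; budget = ≤-trans (≤-reflexive (trans (∑-degree n a f r deg)
                   (cong (_+ n * r) (handshake F f (λ x y → sym (ext-toℕ (has F) x y)) f-sym f-irr))))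
                   (+-monoˡ-≤ (n * r) (+-mono-≤ F≤k F≤k))
      }
      where
      refl-R : ∀ {u} → u < n → T (R u u)
      refl-R u<n with x , refl ← lift u<n = ext⁺ {f = same} x x (same⁺ refl)
      case-sym : ∀ {u v} → ∃[ x ] ∃[ y ] toℕ x ≡ u × toℕ y ≡ v × T (same x y) → T (R v u)
      case-sym (x , y , refl , refl , p) = ext⁺ {f = same} y x (same⁺ (sym (same⁻ {x} {y} p)))
      case-trans : ∀ {u v w} → ∃[ x ] ∃[ y ] toℕ x ≡ u × toℕ y ≡ v × T (same x y) →
                   ∃[ y ] ∃[ z ] toℕ y ≡ v × toℕ z ≡ w × T (same y z) → T (R u w)
      case-trans (x , y , refl , refl , p) (y′ , z , e , refl , q) with refl ← toℕ-injective e =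
        ext⁺ {f = same} x z (same⁺ (trans (same⁻ {y} {z} q) (same⁻ {x} {y} p)))
      adjacent⁺ : ∀ {x y} → x ≢ y → T (same x y) → T (a (toℕ x) (toℕ y)) × ¬ T (f (toℕ x) (toℕ y))
      adjacent⁺ {x} {y} x≢y p =
        let q , ¬r = ∧⁻ {adj (G I) x y} (Equivalence.from (adjacent x y) (x≢y , sym (same⁻ {x} {y} p))) in
        subst T (adj≡a x y) q , λ fxy → not⁻ ¬r (subst T (ext-toℕ (has F) x y) fxy)
      adjacent⁻ : ∀ {x y} → T (a (toℕ x) (toℕ y)) → ¬ T (f (toℕ x) (toℕ y)) → T (same x y) × x ≢ y
      adjacent⁻ {x} {y} p ¬q =
        let x≢y , e = Equivalence.to (adjacent x y)
                        (∧⁺ (subst T (sym (adj≡a x y)) p) (not⁺ λ q → ¬q (ext⁺ x y q))) in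
        same⁺ (sym e) , x≢y
      case-close : ∀ {u v} → ∃[ x ] ∃[ y ] toℕ x ≡ u × toℕ y ≡ v × T (same x y) → T (near a u v)
      case-close (x , y , refl , refl , p) with x ≟ y
      ... | yes refl = near-refl a (toℕ x)
      ... | no  x≢y  = ∨⁺₂ {toℕ x ≡ᵇ toℕ y} (proj₁ (adjacent⁺ x≢y p))
      size-u : ∀ {u} → u < n → # n (R u) ≡ suc r
      size-u u<n with x , refl ← lift u<n = trans (size-R x) s≡
      deg : ∀ u → u < n → degree n a u ≡ degree n f u + r
      deg u u<n with x , refl ← lift u<n = degree-split n u<n (refl-R u<n) (size-u u<n) f⊆a to from
        where
        f⊆a : ∀ v → v < n → T (f (toℕ x) v) → T (a (toℕ x) v)
        f⊆a v v<n p with y , refl ← lift v<n =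
          subst T (adj≡a x y) (F⊆E x y (subst T (ext-toℕ (has F) x y) p))
        to : ∀ v → v < n → T (a (toℕ x) v) → ¬ T (f (toℕ x) v) → T (R (toℕ x) v) × v ≢ toℕ x
        to v v<n p ¬q with y , refl ← lift v<n =
          let r , x≢y = adjacent⁻ p ¬q in ext⁺ {f = same} x y r , λ e → x≢y (sym (toℕ-injective e))
        from : ∀ v → v < n → T (R (toℕ x) v) → v ≢ toℕ x → T (a (toℕ x) v) × ¬ T (f (toℕ x) v)
        from v v<n p v≢x with y , refl ← lift v<n =
          adjacent⁺ (λ { refl → v≢x refl }) (subst T (ext-toℕ same x y) p)
      f-sym : ∀ u v → f u v ≡ f v u
      f-sym u v = T-ext (flip u v) (flip v u)
        where
        flip : ∀ u v → T (f u v) → T (f v u)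
        flip u v p with x , y , refl , refl , q ← ext⁻ {f = has F} {u} {v} p =
          ext⁺ {f = has F} y x (subst T (EdgeSet.sym F x y) q)
      f-irr : ∀ u → ¬ T (f u u)
      f-irr u p with x , y , refl , e , q ← ext⁻ {f = has F} {u} {u} p with refl ← toℕ-injective e =
        subst T (EdgeSet.irrefl F x) q
    go : ∀ m → n ≡ m → Solution n a (k I)
    -- On the empty graph the clique size is arbitrary and may even be 0, so it need not have the
    -- form r + 1; the empty relation with r = 0 is used instead.
    go zero n≡0 = record
      { r = 0
      ; parts = record
        { R = λ _ _ → false ; inside = ⊥-elim ; refl′ = λ u<n → ⊥-elim (n≮0 (subst (_ <_) n≡0 u<n))
        ; sym′ = λ () ; trans′ = λ () ; close = ⊥-elim
        ; size = λ u<n → ⊥-elim (n≮0 (subst (_ <_) n≡0 u<n)) }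
      ; budget = subst (λ m → ∑ m (degree n a) ≤ k I + k I + n * 0) (sym n≡0) z≤n
      }
    go (suc m) n≡ with s in eq
    ... | suc r = build eq
    ... | zero = ⊥-elim (n≮0 (subst (0 <_) (trans (size-R x) eq)
                          (#-pos⁺ n (toℕ<n x) (ext⁺ {f = same} x x (same⁺ refl)))))
      where
      x : Fin n
      x = subst Fin (sym n≡) zero

  Solution⇒UCED : (∀ u v → a u v ≡ a v u) → (∀ u → ¬ T (a u u)) → Solution n a (k I) → UCED I
  Solution⇒UCED a-sym a-irr (solution r parts budget) = F , F⊆E , F≤k , record
    { #cliques = # n isRep
    ; size     = suc r
    ; clique   = clique
    ; adjacent = λ x y → mk⇔ (adjacent⁻ x y) (λ (x≢y , e) → adjacent⁺ x y x≢y e)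
    ; uniform  = uniform
    }
    where
    open Partition parts
    f : Rel
    f u v = a u v ∧ not (R u v)
    R-sym : ∀ u v → R u v ≡ R v u
    R-sym u v = T-ext sym′ sym′
    F : EdgeSet n
    F = record
      { has    = λ x y → f (toℕ x) (toℕ y)
      ; sym    = λ x y → cong₂ (λ p q → p ∧ not q) (a-sym (toℕ x) (toℕ y)) (R-sym (toℕ x) (toℕ y))
      ; irrefl = λ x → T-ext {_} {false} (λ p → a-irr (toℕ x) (proj₁ (∧⁻ p))) ⊥-elim
      }
    F⊆E : F ⊆ₑ edges (G I)
    F⊆E x y p = subst T (sym (adj≡a x y)) (proj₁ (∧⁻ p))

    a∧¬f⇒R : ∀ {u v} → T (a u v) → ¬ T (f u v) → T (R u v)
    a∧¬f⇒R p ¬q = ¬not⁻ λ ¬R → ¬q (∧⁺ p ¬R)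

    deg : ∀ u → u < n → degree n a u ≡ degree n f u + r
    deg u u<n = degree-split n u<n (refl′ u<n tt) (size u<n tt)
      (λ v _ p → proj₁ (∧⁻ p))
      (λ v _ p ¬q → a∧¬f⇒R p ¬q , λ { refl → a-irr u p })
      (λ v _ p v≢u → near⁻ {a} {u} {v} (close p) (v≢u ∘ sym) , λ q → not⁻ (proj₂ (∧⁻ {a u v} q)) p)

    F≤k : ∣ F ∣ₑ ≤ k I
    F≤k = ≮⇒≥ λ k<F → <⇒≱ (+-mono-< k<F k<F) (+-cancelʳ-≤ (n * r) _ _
      (subst (_≤ k I + k I + n * r)
        (trans (∑-degree n a f r deg) (cong (_+ n * r) (handshake F f (λ _ _ → refl)
          (λ u v → cong₂ (λ p q → p ∧ not q) (a-sym u v) (R-sym u v))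
          (λ u p → a-irr u (proj₁ (∧⁻ p))))))
        budget))

    -- A class is represented by its least element, and numbered by the rank of its representative.
    rep : ℕ → ℕ
    rep u = nth n (R u) 0

    isRep : ℕ → Bool
    isRep v = # v (R v) ≡ᵇ 0

    rep-spec : ∀ {u} → u < n → rep u < n × T (R u (rep u)) × # (rep u) (R u) ≡ 0
    rep-spec {u} u<n = nth-spec n (#-pos⁺ n u<n (refl′ u<n tt))

    R⇒#≡ : ∀ {u v} w → T (R u v) → # w (R u) ≡ # w (R v)
    R⇒#≡ w p = #-cong w λ i _ → (λ q → trans′ (sym′ p) q) , trans′ p

    R⇒rep≡ : ∀ {u v} → T (R u v) → rep v ≡ rep u
    R⇒rep≡ {u} {v} p =
      let rep<n , q , z = rep-spec (proj₁ (inside p)) in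
      trans (cong (nth n (R v)) (sym (trans (sym (R⇒#≡ (rep u) p)) z))) (nth-rank {n} {R v} {rep u} rep<n (trans′ (sym′ p) q))

    isRep-rep : ∀ {u} → u < n → T (isRep (rep u))
    isRep-rep {u} u<n = let _ , p , z = rep-spec u<n in ≡⇒≡ᵇ _ 0 (trans (sym (R⇒#≡ (rep u) p)) z)

    isRep⇒rep≡ : ∀ {v} → v < n → T (isRep v) → rep v ≡ v
    isRep⇒rep≡ {v} v<n p =
      trans (cong (nth n (R v)) (sym (≡ᵇ⇒≡ _ 0 p))) (nth-rank {n} {R v} {v} v<n (refl′ v<n tt))

    number : ℕ → ℕ
    number u = # (rep u) isRep

    number< : ∀ {u} → u < n → number u < # n isRep
    number< {u} u<n = let rep<n , _ = rep-spec u<n in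
      subst (_≤ # n isRep) (#-suc {isRep} {rep u} (isRep-rep u<n)) (#-mono-n isRep rep<n)

    nth-number : ∀ {u} → u < n → nth n isRep (number u) ≡ rep u
    nth-number u<n = nth-rank {n} {isRep} (proj₁ (rep-spec u<n)) (isRep-rep u<n)

    number≡⇒R : ∀ {u v} → u < n → v < n → number u ≡ number v → T (R u v)
    number≡⇒R {u} {v} u<n v<n e = trans′ (proj₁ (proj₂ (rep-spec u<n)))
      (subst (λ w → T (R w v)) (trans (sym (nth-number v<n)) (trans (cong (nth n isRep) (sym e)) (nth-number u<n)))
        (sym′ (proj₁ (proj₂ (rep-spec v<n)))))

    R⇒number≡ : ∀ {u v} → T (R u v) → number u ≡ number v
    R⇒number≡ p = cong (λ w → # w isRep) (sym (R⇒rep≡ p))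

    clique : Fin n → Fin (# n isRep)
    clique x = fromℕ< (number< (toℕ<n x))

    clique≡⁻ : ∀ x y → clique x ≡ clique y → T (R (toℕ x) (toℕ y))
    clique≡⁻ x y e = number≡⇒R (toℕ<n x) (toℕ<n y)
      (trans (sym (toℕ-fromℕ< _)) (trans (cong toℕ e) (toℕ-fromℕ< _)))

    clique≡⁺ : ∀ x y → T (R (toℕ x) (toℕ y)) → clique x ≡ clique y
    clique≡⁺ x y p = fromℕ<-cong _ _ (R⇒number≡ p) _ _

    adjacent⁻ : ∀ x y → T (adj (G I -ₑ F) x y) → x ≢ y × clique x ≡ clique y
    adjacent⁻ x y p =
      let q , ¬f = ∧⁻ {adj (G I) x y} p
          axy = subst T (adj≡a x y) q in
      (λ { refl → a-irr (toℕ x) axy }) , clique≡⁺ x y (a∧¬f⇒R axy (not⁻ ¬f))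

    adjacent⁺ : ∀ x y → x ≢ y → clique x ≡ clique y → T (adj (G I -ₑ F) x y)
    adjacent⁺ x y x≢y e = let p = clique≡⁻ x y e in
      ∧⁺ (subst T (sym (adj≡a x y)) (near⁻ {a} {toℕ x} {toℕ y} (close p) (x≢y ∘ toℕ-injective)))
         (not⁺ λ q → not⁻ (proj₂ (∧⁻ {a (toℕ x) (toℕ y)} q)) p)

    uniform : ∀ i → length (filter (λ v → clique v ≟ i) (allFin n)) ≡ suc r
    uniform i = trans (length-filter-tabulate n (λ v → clique v ≟ i) (λ x → x) (R w) same) (size w<n tt)
      where
      w = nth n isRep (toℕ i)
      w-spec = nth-spec n {isRep} (toℕ<n i)
      w<n = proj₁ w-spec
      number-w : number w ≡ toℕ i
      number-w = trans (cong (λ v → # v isRep) (isRep⇒rep≡ w<n (proj₁ (proj₂ w-spec)))) (proj₂ (proj₂ w-spec))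
      same : ∀ x → does (clique x ≟ i) ≡ R w (toℕ x)
      same x = T-ext
        (λ p → number≡⇒R w<n (toℕ<n x) (trans number-w
                 (trans (cong toℕ (sym (does⁻ (clique x ≟ i) p))) (toℕ-fromℕ< _))))
        (λ p → does⁺ (clique x ≟ i) (toℕ-injective
                 (trans (toℕ-fromℕ< _) (trans (sym (R⇒number≡ p)) number-w))))

-- The reduction

#-disjoint : ∀ n {P Q S : ℕ → Bool} →
  (∀ i → i < n → T (P i) → T (S i)) → (∀ i → i < n → T (Q i) → T (S i)) →
  (∀ i → i < n → T (Q i) → ¬ T (P i)) → # n P + # n Q ≤ # n S
#-disjoint n {P} {Q} {S} P⊆S Q⊆S disj = subst (# n P + # n Q ≤_) (sym (#-split n S P)) (+-mono-≤
  (#-mono n λ i i<n p → ∧⁺ (P⊆S i i<n p) p)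
  (#-mono n λ i i<n q → ∧⁺ (Q⊆S i i<n q) (not⁺ (disj i i<n q))))

#-∨ : ∀ n (P Q : ℕ → Bool) → # n (λ i → P i ∨ Q i) ≤ # n P + # n Q
#-∨ n P Q = ≤-trans (∑-mono n λ i _ → le (P i) (Q i)) (≤-reflexive (∑-+ n _ _))
  where
  le : ∀ x y → bit (x ∨ y) ≤ bit x + bit y
  le true  y = s≤s z≤n
  le false y = ≤-refl

∑-if : ∀ n P c → ∑ n (λ i → if P i then c else 0) ≡ # n P * c
∑-if n P c = trans (∑-cong n λ i _ → bit-* (P i)) (∑-* n (bit ∘ P) c)
  where
  bit-* : ∀ b → (if b then c else 0) ≡ bit b * c
  bit-* true  = sym (+-identityʳ c)
  bit-* false = refl

∑-if≤ : ∀ n (P : ℕ → Bool) (f : ℕ → ℕ) → ∑ n (λ i → if P i then f i else 0) ≤ ∑ n f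
∑-if≤ n P f = ∑-mono n λ i _ → le (P i)
  where
  le : ∀ b {x} → (if b then x else 0) ≤ x
  le true  = ≤-refl
  le false = z≤n

-- If `f` were nonzero on all of `P`, the sum would be at least the number of elements of `P`.
∑-small : ∀ n (P : ℕ → Bool) (f : ℕ → ℕ) → ∑ n (λ i → if P i then f i else 0) < # n P →
          ∃[ i ] i < n × T (P i) × f i ≡ 0
∑-small n P f small with T? (any n λ i → P i ∧ (f i ≡ᵇ 0))
... | yes p = let i , i<n , q = any⁻ n p ; Pi , z = ∧⁻ {P i} q in i , i<n , Pi , ≡ᵇ⇒≡ (f i) 0 z
... | no ¬p = ⊥-elim (<⇒≱ small (∑-mono n λ i i<n → le (P i) (f i) λ Pi z → ¬p (any⁺ n i<n (∧⁺ Pi (≡⇒≡ᵇ (f i) 0 z)))))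
  where
  le : ∀ b x → (T b → x ≢ 0) → bit b ≤ (if b then x else 0)
  le false x       _ = z≤n
  le true  zero    f = ⊥-elim (f tt refl)
  le true  (suc x) _ = s≤s z≤n

-- Read `v` as the degree sum on `o` vertices and `x` as its slack over `o * r`. Each decrease of
-- the clique size by one costs a further `o`, while the parameter `suc h` leaves at most 2 to
-- spare. Here `o` is at least 3, since r > r′ makes r positive.
smaller-too-costly : ∀ {o v x h r r′} → v ≡ x + o * r → h + h ≤ x → v ≤ suc h + suc h + o * r′ →
                     r′ < r → suc r < o → ⊥
smaller-too-costly {o} {v} {x} {h} {r} {r′} v≡ h≤ v≤ r′<r r<o =
  <⇒≱ (≤-trans (s≤s (s≤s (≤-trans (s≤s z≤n) r′<r))) r<o) (+-cancelʳ-≤ (x + o * r′) o 2 (begin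
    o + (x + o * r′)            ≡⟨ shuffle o x r′ ⟩
    x + o * suc r′              ≤⟨ +-monoʳ-≤ x (*-monoʳ-≤ o r′<r) ⟩
    x + o * r                   ≡⟨ v≡ ⟨
    v                           ≤⟨ v≤ ⟩
    suc h + suc h + o * r′      ≡⟨ cong (λ y → suc (y + o * r′)) (+-suc h h) ⟩
    2 + (h + h + o * r′)        ≤⟨ +-monoʳ-≤ 2 (+-monoˡ-≤ (o * r′) h≤) ⟩
    2 + (x + o * r′)            ∎))
  where
  open ≤-Reasoning
  shuffle : ∀ o x r → o + (x + o * r) ≡ x + o * suc r
  shuffle = solve-∀

-- Everything computed is spelled with the operations of the term language, so minima, positions and
-- halves are counts and products are sums. The compiled terms then denote these data by computation
-- alone.
module Kernel (n : ℕ) (a : Rel) where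

  infix 4 _~_
  _~_ : Rel
  _~_ = near a

  deg : ℕ → ℕ
  deg = degree n a

  minDegree : ℕ
  minDegree = # n λ x → not (any n λ v → deg v <ᵇ suc x)

  isClique : ℕ → Bool
  isClique c = not (any n λ x → any n λ y → (c ~ x) ∧ (c ~ y) ∧ not (x ~ y))

  excess : ℕ → ℕ
  excess c = ∑ n λ v → if c ~ v then deg v ∸ minDegree else 0

  -- The truncated difference asks for total excess 0 when the minimum degree is 0.
  center : ℕ → Bool
  center c = (deg c ≡ᵇ minDegree) ∧ isClique c ∧ (excess c <ᵇ suc (minDegree ∸ 1))

  forced : ℕ → Bool
  forced v = any n λ c → center c ∧ (c ~ v)

  someFree : Bool
  someFree = any n λ v → not (forced v)

  center₀ : ℕ
  center₀ = nth n center 0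

  -- A free vertex lies outside the closed neighbourhood of any center, so with the guard `someFree`
  -- a nonempty kept graph has more than r + 1 vertices. Excluding smaller cliques relies on this
  -- strict inequality.
  kept : ℕ → Bool
  kept v = not (forced v) ∨ (someFree ∧ (center₀ ~ v))

  order′ : ℕ
  order′ = # n kept

  volume volume′ need need′ : ℕ
  volume  = ∑ n λ u → deg u
  volume′ = ∑ n λ u → # n λ v → kept u ∧ kept v ∧ a u v
  need    = ∑ n λ _ → minDegree
  need′   = ∑ n λ u → if kept u then minDegree else 0

  -- Half the slack, rounded down, provided that this is at most `n`, the range of the count.
  half : ℕ
  half = # n λ i → suc (i + i) <ᵇ volume′ ∸ need′

  -- In turn: the original budget for cliques of size `minDegree` + 1; exactness of the truncated
  -- difference `volume′ ∸ need′`; the bound that keeps `half` at most k; the size of the kernel.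
  accepts : ℕ → Bool
  accepts k = (volume <ᵇ suc (k + k + need)) ∧ (need′ <ᵇ suc volume′) ∧
              (volume′ <ᵇ suc (k + k + need′)) ∧ (order′ <ᵇ suc (k + k + (k + k) + (k + k)))

  induced : Rel
  induced i j = a (nth n kept i) (nth n kept j)

  module Properties (a-sym : ∀ {u v} → T (a u v) → T (a v u)) (a-irr : ∀ {u} → ¬ T (a u u))
                    (a-inside : ∀ {u v} → T (a u v) → v < n) where

    r : ℕ
    r = minDegree

    ~-inside : ∀ {u v} → u < n → T (u ~ v) → v < n
    ~-inside {u} {v} u<n p with ∨⁻ {u ≡ᵇ v} p
    ... | inj₁ e = subst (_< n) (≡ᵇ⇒≡ u v e) u<n
    ... | inj₂ q = a-inside q

    #-near : ∀ {u} → u < n → # n (u ~_) ≡ suc (deg u)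
    #-near {u} u<n = trans (∑-cong n λ v _ → split v) (trans (∑-+ n (λ v → bit (u ≡ᵇ v)) (bit ∘ a u))
      (cong (_+ deg u) (trans (#-cong n λ v _ → (λ p → ≡⇒≡ᵇ v u (sym (≡ᵇ⇒≡ u v p))) , (λ p → ≡⇒≡ᵇ u v (sym (≡ᵇ⇒≡ v u p))))
                              (#-single n u u<n))))
      where
      disj : ∀ x y → ¬ (T x × T y) → bit (x ∨ y) ≡ bit x + bit y
      disj true  true  f = ⊥-elim (f _)
      disj true  false f = refl
      disj false y     f = refl
      split : ∀ v → bit (u ~ v) ≡ bit (u ≡ᵇ v) + bit (a u v)
      split v = disj (u ≡ᵇ v) (a u v) λ (e , p) → a-irr (subst (T ∘ a u) (sym (≡ᵇ⇒≡ u v e)) p)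

    record Center (c : ℕ) : Set where
      field
        c<n    : c < n
        deg≡   : deg c ≡ r
        clique : ∀ {x y} → T (c ~ x) → T (c ~ y) → T (x ~ y)
        small  : excess c ≤ pred r

      #≡ : # n (c ~_) ≡ suc r
      #≡ = trans (#-near c<n) (cong suc deg≡)

    center⁻ : ∀ {c} → c < n → T (center c) → Center c
    center⁻ {c} c<n p =
      let p₁ , p₂₃ = ∧⁻ p ; p₂ , p₃ = ∧⁻ {isClique c} p₂₃ in record
      { c<n    = c<n
      ; deg≡   = ≡ᵇ⇒≡ _ _ p₁
      ; clique = λ {x} {y} cx cy → ¬not⁻ λ q → not⁻ p₂
          (any⁺ n (~-inside c<n cx) (any⁺ n (~-inside c<n cy) (∧⁺ cx (∧⁺ cy q))))
      ; small  = ≤-pred (<ᵇ⇒< (excess c) _ p₃)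
      }

    center⁺ : ∀ {c} → Center c → T (center c)
    center⁺ {c} C = ∧⁺ (≡⇒≡ᵇ _ _ deg≡) (∧⁺
      (not⁺ λ p → let x , _ , q = any⁻ n p
                      y , _ , s = any⁻ n q
                      cx , t = ∧⁻ {c ~ x} s
                      cy , ¬xy = ∧⁻ {c ~ y} t
                  in not⁻ ¬xy (clique cx cy))
      (<⇒<ᵇ (s≤s small)))
      where open Center C

    forced⁻ : ∀ {v} → T (forced v) → ∃[ c ] Center c × T (c ~ v)
    forced⁻ {v} p = let c , c<n , q = any⁻ n p ; s , t = ∧⁻ {center c} q in c , center⁻ c<n s , t

    forced⁺ : ∀ {c v} → Center c → T (c ~ v) → T (forced v)
    forced⁺ C p = any⁺ n (Center.c<n C) (∧⁺ (center⁺ C) p)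

    record Clique (A : ℕ → Bool) : Set where
      field
        #≡    : # n A ≡ suc r
        close : ∀ {x y} → T (A x) → T (A y) → T (x ~ y)

    near-clique : ∀ {c} → Center c → Clique (c ~_)
    near-clique C = record { #≡ = Center.#≡ C ; close = Center.clique C }

    -- If A met the neighbourhood of c in p vertices and left it in q ≥ 1 vertices, each of the p
    -- would have q neighbours outside, so that p q ≤ excess c; but p q ≥ p + q - 1 = r.
    absorb⊆ : ∀ {c A y} → Center c → Clique A → y < n → T (A y) → T (c ~ y) →
              ∀ z → z < n → T (A z) → T (c ~ z)
    absorb⊆ {c} {A} {y} C K y<n Ay cy z z<n Az = ¬not⁻ λ ¬cz → contra ¬cz
      where
      open Center C
      inner outer : ℕ → Bool
      inner v = A v ∧ (c ~ v)
      outer v = A v ∧ not (c ~ v)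
      p q : ℕ
      p = # n inner
      q = # n outer
      p+q : p + q ≡ suc r
      p+q = trans (sym (#-split n A (c ~_))) (Clique.#≡ K)
      q≤ : ∀ v → v < n → T (inner v) → q ≤ deg v ∸ r
      q≤ v v<n Iv = let Av , cv = ∧⁻ {A v} Iv in subst (_≤ deg v ∸ r) (m+n∸m≡n r q) (∸-monoˡ-≤ r (≤-pred (begin
        suc r + q         ≡⟨ cong (_+ q) #≡ ⟨
        # n (c ~_) + q    ≤⟨ #-disjoint n (λ w _ cw → clique cv cw)
                               (λ w _ Ow → Clique.close K Av (proj₁ (∧⁻ {A w} Ow)))
                               (λ w _ Ow → not⁻ (proj₂ (∧⁻ {A w} Ow))) ⟩
        # n (v ~_)        ≡⟨ #-near v<n ⟩
        suc (deg v)       ∎)))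
        where open ≤-Reasoning
      pq≤ : p * q ≤ pred r
      pq≤ = ≤-trans (≤-reflexive (sym (∑-if n inner q)))
              (≤-trans (∑-mono n λ v v<n → term v v<n) small)
        where
        term : ∀ v → v < n → (if inner v then q else 0) ≤ (if c ~ v then deg v ∸ r else 0)
        term v v<n with T? (inner v)
        ... | yes Iv rewrite if-true {x = q} {0} Iv
                           | if-true {x = deg v ∸ r} {0} (proj₂ (∧⁻ {A v} Iv)) = q≤ v v<n Iv
        ... | no ¬Iv rewrite if-false {x = q} {0} ¬Iv = z≤n
      arith : ∀ p q r → 1 ≤ p → 1 ≤ q → p + q ≡ suc r → p * q ≤ pred r → ⊥
      arith (suc p) (suc q) r _ _ e le with refl ← trans (sym (suc-injective e)) (+-suc p q) =
        <⇒≱ (s≤s (≤-trans (≤-reflexive (+-comm p q)) (+-monoʳ-≤ q (m≤m*n p (suc q))))) le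
      contra : T (not (c ~ z)) → ⊥
      contra ¬cz = arith p q r (#-pos⁺ n y<n (∧⁺ Ay cy)) (#-pos⁺ n z<n (∧⁺ Az ¬cz)) p+q pq≤

    class-clique : ∀ {W u} (P : Partition n a W r) → u < n → T (W u) → Clique (Partition.R P u)
    class-clique P u<n Wu = record { #≡ = size u<n Wu ; close = λ p q → close (trans′ (sym′ p) q) }
      where open Partition P

    kept-free : ∀ {v} → ¬ T (forced v) → T (kept v)
    kept-free p = ∨⁺₁ (not⁺ p)

    ¬kept⇒forced : ∀ {v} → ¬ T (kept v) → T (forced v)
    ¬kept⇒forced p = ¬not⁻ λ q → p (∨⁺₁ q)

    find-center : ∀ {v} → T (forced v) → Center center₀
    find-center p = let c , C , _ = forced⁻ p
                        c₀<n , q , _ = nth-spec n {center} (#-pos⁺ n (Center.c<n C) (center⁺ C))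
                    in center⁻ c₀<n q

    -- A class is kept or dropped as a whole: by `absorb⊆`, a class that meets the closed
    -- neighbourhood of a center stays inside it.
    restrict : Center center₀ → Partition n a all r → Partition n a kept r
    restrict C₀ P = record
      { R      = R′
      ; inside = λ {u} {v} p → let q , Ru = ∧⁻ {kept u} p in proj₁ (inside Ru) , q
      ; refl′  = λ u<n Wu → ∧⁺ Wu (refl′ u<n tt)
      ; sym′   = λ {u} {v} p → let q , Ru = ∧⁻ {kept u} p in ∧⁺ (closed Ru q) (sym′ Ru)
      ; trans′ = λ {u} {v} {w} p q → let Wu , Ru = ∧⁻ {kept u} p in ∧⁺ Wu (trans′ Ru (proj₂ (∧⁻ {kept v} q)))
      ; close  = λ {u} p → close (proj₂ (∧⁻ {kept u} p))
      ; size   = λ {u} u<n Wu → trans (#-cong n λ v _ → (λ p → proj₂ (∧⁻ {kept u} p)) , ∧⁺ Wu) (size u<n tt)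
      }
      where
      open Partition P
      R′ : Rel
      R′ u v = kept u ∧ R u v
      class⊆ : ∀ {c u v} → Center c → T (R u v) → T (c ~ u) → T (c ~ v)
      class⊆ C p cu = let u<n = proj₁ (inside p) in
        absorb⊆ C (class-clique P u<n tt) u<n (refl′ u<n tt) cu _ (proj₁ (inside (sym′ p))) p
      closed : ∀ {u v} → T (R u v) → T (kept u) → T (kept v)
      closed {u} {v} p Wu with ∨⁻ {not (forced u)} Wu
      ... | inj₁ free = kept-free λ f → let c , C , cv = forced⁻ f in
                          not⁻ free (forced⁺ C (class⊆ C (sym′ p) cv))
      ... | inj₂ q = let s , t = ∧⁻ {someFree} q in ∨⁺₂ {not (forced v)} (∧⁺ s (class⊆ C₀ p t))

    -- Dropped vertices are grouped by the closed neighbourhoods of centers. These are pairwise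
    -- equal or disjoint (`coincide`), and those of dropped vertices contain no kept vertex
    -- (`removed`).
    extend : Center center₀ → Partition n a kept r → Partition n a all r
    extend C₀ P = record
      { R      = R′
      ; inside = λ p → inside′ p , tt
      ; refl′  = λ {u} u<n _ → refl″ u<n
      ; sym′   = sym″
      ; trans′ = trans″
      ; close  = close′
      ; size   = λ u<n _ → size′ u<n
      }
      where
      open Partition P
      grouped : Rel
      grouped u v = any n λ c → center c ∧ (c ~ u) ∧ (c ~ v)
      R′ : Rel
      R′ u v = R u v ∨ (not (kept u) ∧ grouped u v)
      grouped⁺ : ∀ {c u v} → Center c → T (c ~ u) → T (c ~ v) → T (grouped u v)
      grouped⁺ C p q = any⁺ n (Center.c<n C) (∧⁺ (center⁺ C) (∧⁺ p q))
      data Case (u v : ℕ) : Set where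
        old : T (R u v) → Case u v
        new : ∀ {c} → ¬ T (kept u) → Center c → T (c ~ u) → T (c ~ v) → Case u v
      case⁻ : ∀ {u v} → T (R′ u v) → Case u v
      case⁻ {u} {v} p with ∨⁻ {R u v} p
      ... | inj₁ q = old q
      ... | inj₂ q = let ¬Wu , g = ∧⁻ q
                         c , c<n , s = any⁻ n g
                         Cc , s′ = ∧⁻ {center c} s
                         cu , cv = ∧⁻ {c ~ u} s′
                     in new (not⁻ ¬Wu) (center⁻ c<n Cc) cu cv
      case⁺ : ∀ {u v} → Case u v → T (R′ u v)
      case⁺ (old p)           = ∨⁺₁ p
      case⁺ {u} {v} (new ¬Wu C p q) = ∨⁺₂ {R u v} (∧⁺ (not⁺ ¬Wu) (grouped⁺ C p q))
      -- The closed neighbourhood of a center is itself a clique of size r + 1, so `absorb⊆` applies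
      -- to it.
      coincide : ∀ {c c′ y z} → Center c → Center c′ → T (c ~ y) → T (c′ ~ y) → T (c′ ~ z) → T (c ~ z)
      coincide C C′ cy c′y c′z = absorb⊆ C (near-clique C′) (~-inside (Center.c<n C) cy) c′y cy _
                                  (~-inside (Center.c<n C′) c′z) c′z
      -- A kept `v` is not free, as `c` forces it, so it is near `center₀`; the two neighbourhoods
      -- then meet, and `u` would be kept as well.
      removed : ∀ {c u v} → ¬ T (kept u) → Center c → T (c ~ u) → T (c ~ v) → ¬ T (kept v)
      removed {c} {u} {v} ¬Wu C cu cv Wv with ∨⁻ {not (forced v)} Wv
      ... | inj₁ free = not⁻ free (forced⁺ C cv)
      ... | inj₂ q = let s , c₀v = ∧⁻ {someFree} q in
                     ¬Wu (∨⁺₂ {not (forced u)} (∧⁺ s (coincide C₀ C c₀v cv cu)))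
      inside′ : ∀ {u v} → T (R′ u v) → u < n
      inside′ p with case⁻ p
      ... | old q        = proj₁ (inside q)
      ... | new _ C cu _ = ~-inside (Center.c<n C) cu
      refl″ : ∀ {u} → u < n → T (R′ u u)
      refl″ {u} u<n with T? (kept u)
      ... | yes Wu = case⁺ (old (refl′ u<n Wu))
      ... | no ¬Wu = let c , C , cu = forced⁻ (¬kept⇒forced ¬Wu) in case⁺ (new ¬Wu C cu cu)
      sym″ : ∀ {u v} → T (R′ u v) → T (R′ v u)
      sym″ p with case⁻ p
      ... | old q            = case⁺ (old (sym′ q))
      ... | new ¬Wu C cu cv  = case⁺ (new (removed ¬Wu C cu cv) C cv cu)
      trans″ : ∀ {u v w} → T (R′ u v) → T (R′ v w) → T (R′ u w)
      trans″ p q with case⁻ p | case⁻ q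
      ... | old p′           | old q′           = case⁺ (old (trans′ p′ q′))
      ... | old p′           | new ¬Wv _ _ _    = ⊥-elim (¬Wv (proj₂ (inside (sym′ p′))))
      ... | new ¬Wu C cu cv  | old q′           = ⊥-elim (removed ¬Wu C cu cv (proj₂ (inside q′)))
      ... | new ¬Wu C cu cv  | new _ C′ cv′ cw  = case⁺ (new ¬Wu C cu (coincide C C′ cv cv′ cw))
      close′ : ∀ {u v} → T (R′ u v) → T (u ~ v)
      close′ p with case⁻ p
      ... | old q            = close q
      ... | new _ C cu cv    = Center.clique C cu cv
      size′ : ∀ {u} → u < n → # n (R′ u) ≡ suc r
      size′ {u} u<n with T? (kept u)
      ... | yes Wu = trans (#-cong n λ v _ → to v , λ p → case⁺ (old p)) (size u<n Wu)
        where
        to : ∀ v → T (R′ u v) → T (R u v)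
        to v p with case⁻ p
        ... | old q         = q
        ... | new ¬Wu _ _ _ = ⊥-elim (¬Wu Wu)
      ... | no ¬Wu with c , C , cu ← forced⁻ (¬kept⇒forced ¬Wu) =
        trans (#-cong n λ v _ → to v , λ cv → case⁺ (new ¬Wu C cu cv)) (Center.#≡ C)
        where
        to : ∀ v → T (R′ u v) → T (c ~ v)
        to v p with case⁻ p
        ... | old q             = ⊥-elim (¬Wu (proj₂ (inside q)))
        ... | new _ C′ c′u c′v  = coincide C C′ cu c′u c′v

    free : ℕ → Bool
    free v = not (forced v)

    need≡ : need ≡ n * r
    need≡ = ∑-const n r

    need′≡ : need′ ≡ order′ * r
    need′≡ = ∑-if n kept r

    class⊆near : ∀ {W r₀ u} (P : Partition n a W r₀) → ∀ v → v < n → T (Partition.R P u v) → T (u ~ v)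
    class⊆near P v _ = Partition.close P

    minDegree≡ : ∀ {r₀} → (∀ v → v < n → r₀ ≤ deg v) → ∃[ v ] v < n × deg v ≤ r₀ → r ≡ r₀
    minDegree≡ {r₀} lower (v , v<n , dv≤) = trans (#-cong n λ x _ → to x , from x)
      (#-< (≤-trans (lower v v<n) (#≤ n (a v))))
      where
      to : ∀ x → T (not (any n λ v → deg v <ᵇ suc x)) → T (x <ᵇ r₀)
      to x p = <⇒<ᵇ (≰⇒> λ r₀≤x → not⁻ p (any⁺ n v<n (<⇒<ᵇ (s≤s (≤-trans dv≤ r₀≤x)))))
      from : ∀ x → T (x <ᵇ r₀) → T (not (any n λ v → deg v <ᵇ suc x))
      from x p = not⁺ λ q → let w , w<n , dw = any⁻ n q in
        <⇒≱ (<-≤-trans (<ᵇ⇒< x r₀ p) (lower w w<n)) (≤-pred (<ᵇ⇒< (deg w) (suc x) dw))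

    -- A solution on more than 6k vertices passes every test

    module Accept {k r₀} (large : k + k + (k + k) + (k + k) < n) (P : Partition n a all r₀)
                  (budget : volume ≤ k + k + n * r₀) where

      deg≥ : ∀ v → v < n → r₀ ≤ deg v
      deg≥ v v<n = ≤-pred (begin
        suc r₀                   ≡⟨ Partition.size P v<n tt ⟨
        # n (Partition.R P v)    ≤⟨ #-mono n (class⊆near P) ⟩
        # n (v ~_)               ≡⟨ #-near v<n ⟩
        suc (deg v)              ∎)
        where open ≤-Reasoning

      ∑excess₀ : ∑ n (λ v → deg v ∸ r₀) ≤ k + k
      ∑excess₀ = +-cancelʳ-≤ (n * r₀) _ _ (≤-trans (≤-reflexive (begin
        ∑ n (λ v → deg v ∸ r₀) + n * r₀            ≡⟨ cong (∑ n (λ v → deg v ∸ r₀) +_) (∑-const n r₀) ⟨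
        ∑ n (λ v → deg v ∸ r₀) + ∑ n (λ _ → r₀)    ≡⟨ ∑-+ n (λ v → deg v ∸ r₀) (λ _ → r₀) ⟨
        ∑ n (λ v → deg v ∸ r₀ + r₀)                ≡⟨ ∑-cong n (λ v v<n → m∸n+n≡m (deg≥ v v<n)) ⟩
        volume                                     ∎)) budget)
        where open ≡-Reasoning

      2k<n : k + k < n
      2k<n = ≤-<-trans (≤-trans (m≤m+n (k + k) (k + k)) (m≤m+n _ (k + k))) large

      #all : # n all ≡ n
      #all = trans (∑-const n 1) (*-identityʳ n)

      -- The excesses over r₀ sum to at most 2k < n, so some vertex has degree exactly r₀.
      r≡r₀ : r ≡ r₀
      r≡r₀ =
        let v , v<n , _ , z = ∑-small n all (λ v → deg v ∸ r₀)
              (subst (∑ n (λ v → deg v ∸ r₀) <_) (sym #all) (≤-<-trans ∑excess₀ 2k<n))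
        in minDegree≡ deg≥ (v , v<n , m∸n≡0⇒m≤n z)

    module Accept′ {k} (large : k + k + (k + k) + (k + k) < n) (P : Partition n a all r)
                   (budget : volume ≤ k + k + n * r) where

      open Accept {k} large P budget using (deg≥; ∑excess₀; 2k<n)
      open Partition P

      e : ℕ → ℕ
      e v = deg v ∸ r

      K s m : ℕ
      K = k + k
      s = # n free
      m = suc (pred r)

      classExcess : ℕ → ℕ
      classExcess u = ∑ n λ v → if R u v then e v else 0

      -- A class of small excess has a vertex without excess, which is then a center.
      free⇒excess : ∀ {u} → u < n → T (free u) → m ≤ classExcess u
      free⇒excess {u} u<n fr = ≰⇒> λ small →
        let w , w<n , Ruw , ew≡0 = ∑-small n (R u) e
              (≤-<-trans small (subst (pred r <_) (sym (size u<n tt)) (s≤s pred[n]≤n)))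
            deg≡ : deg w ≡ r
            deg≡ = ≤-antisym (m∸n≡0⇒m≤n ew≡0) (deg≥ w w<n)
            to : ∀ v → T (R u v) → T (w ~ v)
            to v p = close (trans′ (sym′ Ruw) p)
            from : ∀ v → v < n → T (w ~ v) → T (R u v)
            from = #-⊇ n (λ v _ → to v)
              (≤-reflexive (trans (#-near w<n) (trans (cong suc deg≡) (sym (size u<n tt)))))
            C : Center w
            C = record
              { c<n    = w<n
              ; deg≡   = deg≡
              ; clique = λ {x} {y} wx wy → close (trans′ (sym′ (from x (~-inside w<n wx) wx)) (from y (~-inside w<n wy) wy))
              ; small  = ≤-trans (≤-reflexive (∑-cong n λ v v<n →
                           cong (λ b → if b then e v else 0) (T-ext (from v v<n) (to v)))) small
              }
        in not⁻ fr (forced⁺ C (to u (refl′ u<n tt)))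

      -- Double counting: summing class excesses over all vertices counts the excess of each vertex
      -- once per member of its class, that is r + 1 times.
      s*m≤ : s * m ≤ K * suc r
      s*m≤ = begin
        s * m                                            ≡⟨ ∑-if n free m ⟨
        ∑ n (λ u → if free u then m else 0)              ≤⟨ ∑-mono n term ⟩
        ∑ n classExcess                                  ≡⟨ ∑-swap n n (λ u v → if R u v then e v else 0) ⟩
        ∑ n (λ v → ∑ n (λ u → if R u v then e v else 0)) ≡⟨ ∑-cong n (λ v v<n → trans (∑-if n (λ u → R u v) (e v))
                                                              (trans (*-comm _ (e v)) (cong (e v *_) (column v v<n)))) ⟩
        ∑ n (λ v → e v * suc r)                          ≡⟨ ∑-* n e (suc r) ⟩
        ∑ n e * suc r                                    ≤⟨ *-monoˡ-≤ (suc r) ∑excess₀ ⟩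
        K * suc r                                        ∎
        where
        open ≤-Reasoning
        column : ∀ v → v < n → # n (λ u → R u v) ≡ suc r
        column v v<n = trans (#-cong n λ u _ → sym′ , sym′) (size v<n tt)
        term : ∀ u → u < n → (if free u then m else 0) ≤ classExcess u
        term u u<n with T? (free u)
        ... | yes p rewrite if-true {x = m} {0} p = free⇒excess u<n p
        ... | no ¬p rewrite if-false {x = m} {0} ¬p = z≤n

      m≤K : 0 < s → m ≤ K
      m≤K 0<s = let u , u<n , p = #-pos⁻ n 0<s in
        ≤-trans (free⇒excess u<n p) (≤-trans (∑-if≤ n (R u) e) ∑excess₀)

      -- The quotient of r + 1 by max(r, 1) is at most 2. As n > 3K, a forced vertex is left over,
      -- which makes `center₀` a center.
      s≤2K : s ≤ K + K
      s≤2K = bound r s*m≤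
        where
        bound : ∀ r → s * suc (pred r) ≤ K * suc r → s ≤ K + K
        bound zero    p = ≤-trans (subst₂ _≤_ (*-identityʳ s) (*-identityʳ K) p) (m≤m+n K K)
        bound (suc r) p = *-cancelʳ-≤ s (K + K) (suc r) (≤-trans p (begin
          K * suc (suc r)       ≡⟨ *-suc K (suc r) ⟩
          K + K * suc r         ≤⟨ +-monoˡ-≤ (K * suc r) (m≤m*n K (suc r)) ⟩
          K * suc r + K * suc r ≡⟨ *-distribʳ-+ (suc r) K K ⟨
          (K + K) * suc r       ∎))
          where open ≤-Reasoning

      C₀ : Center center₀
      C₀ = let v , _ , f = #-pos⁻ n 0<forced in find-center f
        where
        0<forced : 0 < # n forced
        0<forced = +-cancelʳ-< s 0 (# n forced) (subst (s <_) (sym (#-not n forced))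
          (≤-<-trans s≤2K (≤-<-trans (m≤m+n (K + K) K) large)))

      order′≤ : order′ ≤ K + K + K
      order′≤ with s ℕ.≟ 0
      ... | yes s≡0 = ≤-trans (≤-reflexive (#-empty n none)) z≤n
        where
        ¬free : ∀ v → v < n → ¬ T (free v)
        ¬free v v<n p = <⇒≢ (#-pos⁺ n v<n p) (sym s≡0)
        none : ∀ v → v < n → T (kept v) → ⊥
        none v v<n p with ∨⁻ {not (forced v)} p
        ... | inj₁ q = ¬free v v<n q
        ... | inj₂ q = let w , w<n , fw = any⁻ n (proj₁ (∧⁻ {someFree} q)) in ¬free w w<n fw
      ... | no s≢0 = ≤-trans (≤-trans (#-mono n keep) (≤-trans (#-∨ n free (center₀ ~_))
                       (≤-reflexive (cong (s +_) (Center.#≡ C₀)))))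
                       (bound k r (m≤K (n≢0⇒n>0 s≢0)) s*m≤)
        where
        keep : ∀ v → v < n → T (kept v) → T (free v ∨ (center₀ ~ v))
        keep v _ p with ∨⁻ {not (forced v)} p
        ... | inj₁ q = ∨⁺₁ q
        ... | inj₂ q = ∨⁺₂ {free v} (proj₂ (∧⁻ {someFree} q))
        -- Write K for k + k. If r is at least 2, then (r + 1) / r is at most 3/2, so 2s is at most
        -- 3K; since r and 2 are at most K, twice the left side is at most 6K. If r = 1, then s is
        -- at most 2K and r + 1 = 2 at most K. If r = 0, then s is at most K.
        bound : ∀ k r → suc (pred r) ≤ k + k → s * suc (pred r) ≤ (k + k) * suc r →
                s + suc r ≤ (k + k) + (k + k) + (k + k)
        bound zero    r             ()
        bound (suc k) zero          _  p = +-mono-≤ (≤-trans (subst₂ _≤_ (*-identityʳ s) (*-identityʳ (suc k + suc k)) p)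
          (m≤m+n (suc k + suc k) (suc k + suc k))) (s≤s z≤n)
        bound (suc k) (suc zero)    _  p = +-mono-≤ (≤-trans (subst (_≤ _) (*-identityʳ s) p)
          (≤-reflexive (trans (*-comm (suc k + suc k) 2) (cong (suc k + suc k +_) (+-identityʳ _)))))
          (≤-trans (s≤s (s≤s z≤n)) (≤-reflexive (cong suc (sym (+-suc k k)))))
        bound k@(suc _) r@(suc (suc r′)) r≤K p = *-cancelˡ-≤ 2 (begin
          2 * (s + suc r)                     ≡⟨ split s r ⟩
          2 * s + (r + r) + 2                 ≤⟨ +-mono-≤ (+-mono-≤ 2s≤ (+-mono-≤ r≤K r≤K)) 2≤L ⟩
          3 * L + (L + L) + L                 ≡⟨ join L ⟩
          2 * (L + L + L)                     ∎)
          where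
          open ≤-Reasoning
          L = k + k
          2≤L : 2 ≤ L
          2≤L = ≤-trans (s≤s (s≤s z≤n)) r≤K
          split : ∀ s r → 2 * (s + suc r) ≡ 2 * s + (r + r) + 2
          split = solve-∀
          join : ∀ L → 3 * L + (L + L) + L ≡ 2 * (L + L + L)
          join = solve-∀
          assoc₁ : ∀ s r → 2 * s * r ≡ 2 * (s * r)
          assoc₁ = solve-∀
          expand : ∀ L r → 2 * (L * suc r) ≡ L * (r + r + 2)
          expand = solve-∀
          collect : ∀ L r → L * (r + r + r) ≡ 3 * L * r
          collect = solve-∀
          2s≤ : 2 * s ≤ 3 * L
          2s≤ = *-cancelʳ-≤ (2 * s) (3 * L) r (begin
            2 * s * r          ≡⟨ assoc₁ s r ⟩
            2 * (s * r)        ≤⟨ *-monoʳ-≤ 2 p ⟩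
            2 * (L * suc r)    ≡⟨ expand L r ⟩
            L * (r + r + 2)    ≤⟨ *-monoʳ-≤ L (+-monoʳ-≤ (r + r) (s≤s (s≤s z≤n))) ⟩
            L * (r + r + r)    ≡⟨ collect L r ⟩
            3 * L * r          ∎)

      restricted : Partition n a kept r
      restricted = restrict C₀ P

      degree′ : ℕ → ℕ
      degree′ u = # n λ v → kept u ∧ kept v ∧ a u v

      -- The whole class of a kept vertex is kept, which leaves the vertex r kept neighbours.
      need′≤ : need′ ≤ volume′
      need′≤ = ∑-mono n term
        where
        module Q = Partition restricted
        term : ∀ u → u < n → (if kept u then r else 0) ≤ degree′ u
        term u u<n with T? (kept u)
        ... | no ¬p rewrite if-false {x = r} {0} ¬p = z≤n
        ... | yes p rewrite if-true {x = r} {0} p = ≤-pred (begin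
          suc r                                          ≡⟨ Q.size u<n p ⟨
          # n (Q.R u)                                    ≤⟨ #-mono n (λ v _ → to v) ⟩
          # n (λ v → (v ≡ᵇ u) ∨ (kept u ∧ kept v ∧ a u v)) ≤⟨ #-∨ n (_≡ᵇ u) _ ⟩
          # n (_≡ᵇ u) + degree′ u                        ≡⟨ cong (_+ degree′ u) (#-single n u u<n) ⟩
          suc (degree′ u)                                ∎)
          where
          open ≤-Reasoning
          to : ∀ v → T (Q.R u v) → T ((v ≡ᵇ u) ∨ (kept u ∧ kept v ∧ a u v))
          to v q with ∨⁻ {u ≡ᵇ v} (Q.close q)
          ... | inj₁ u≡v = ∨⁺₁ (≡⇒≡ᵇ v u (sym (≡ᵇ⇒≡ u v u≡v)))
          ... | inj₂ auv = ∨⁺₂ {v ≡ᵇ u} (∧⁺ p (∧⁺ (proj₂ (Q.inside (Q.sym′ q))) auv))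

      -- Dropping vertices only lowers degrees, so a kept vertex has at most r plus its original
      -- excess many kept neighbours.
      volume′≤ : volume′ ≤ k + k + need′
      volume′≤ = begin
        volume′                                         ≤⟨ ∑-mono n term ⟩
        ∑ n (λ u → e u + (if kept u then r else 0))     ≡⟨ ∑-+ n e _ ⟩
        ∑ n e + need′                                   ≤⟨ +-monoˡ-≤ need′ ∑excess₀ ⟩
        k + k + need′                                   ∎
        where
        open ≤-Reasoning
        term : ∀ u → u < n → degree′ u ≤ e u + (if kept u then r else 0)
        term u u<n with T? (kept u)
        ... | no ¬p = ≤-trans (≤-reflexive (#-empty n λ v _ q → ¬p (proj₁ (∧⁻ {kept u} q)))) z≤n
        ... | yes p rewrite if-true {x = r} {0} p =
          ≤-trans (#-mono n λ v _ q → proj₂ (∧⁻ {kept v} (proj₂ (∧⁻ {kept u} q))))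
                  (≤-reflexive (sym (m∸n+n≡m (deg≥ u u<n))))

      accepted : T (accepts k)
      accepted = ∧⁺ (<⇒<ᵇ (s≤s (subst (λ x → volume ≤ k + k + x) (sym need≡) budget)))
        (∧⁺ (<⇒<ᵇ (s≤s need′≤)) (∧⁺ (<⇒<ᵇ (s≤s volume′≤)) (<⇒<ᵇ (s≤s order′≤))))

    -- Renumbering the kept vertices

    ι : ℕ → ℕ
    ι = nth n kept

    ι-spec : ∀ {i} → i < order′ → ι i < n × T (kept (ι i)) × # (ι i) kept ≡ i
    ι-spec = nth-spec n

    ρ : ℕ → ℕ
    ρ v = # v kept

    ι-ρ : ∀ {v} → v < n → T (kept v) → ι (ρ v) ≡ v
    ι-ρ {v} = nth-rank {n} {kept} {v}

    ρ< : ∀ {v} → v < n → T (kept v) → ρ v < order′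
    ρ< {v} v<n Wv = subst (_≤ order′) (#-suc {kept} {v} Wv) (#-mono-n kept v<n)

    volume-induced : ∑ order′ (degree order′ induced) ≡ volume′
    volume-induced = begin
      ∑ order′ (λ i → ∑ order′ (λ j → bit (a (ι i) (ι j))))
        ≡⟨ ∑-cong order′ (λ i _ → ∑-nth n kept (λ v → bit (a (ι i) v))) ⟩
      ∑ order′ (λ i → row (ι i))
        ≡⟨ ∑-nth n kept row ⟩
      ∑ n (λ u → if kept u then row u else 0)
        ≡⟨ ∑-cong n (λ u _ → gather (kept u) u) ⟩
      volume′ ∎
      where
      open ≡-Reasoning
      row : ℕ → ℕ
      row u = ∑ n λ v → if kept v then bit (a u v) else 0
      bit-∧ : ∀ x y → (if x then bit y else 0) ≡ bit (x ∧ y)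
      bit-∧ true  y = refl
      bit-∧ false y = refl
      gather : ∀ b u → (if b then row u else 0) ≡ # n (λ v → b ∧ kept v ∧ a u v)
      gather true  u = ∑-cong n λ v _ → bit-∧ (kept v) (a u v)
      gather false u = sym (trans (∑-const n 0) (*-zeroʳ n))

    induce : ∀ {r} → Partition n a kept r → Partition order′ induced all r
    induce {r} P = record
      { R      = R′
      ; inside = λ {i} p → <ᵇ⇒< i order′ (proj₁ (∧⁻ p)) , tt
      ; refl′  = λ i< _ → let ι< , Wι , _ = ι-spec i< in ∧⁺ (<⇒<ᵇ i<) (∧⁺ (<⇒<ᵇ i<) (refl′ ι< Wι))
      ; sym′   = λ {i} {j} p → let i< , q = ∧⁻ {i <ᵇ order′} p ; j< , s = ∧⁻ {j <ᵇ order′} q in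
                   ∧⁺ j< (∧⁺ i< (sym′ s))
      ; trans′ = λ {i} {j} {l} p q →
                   let i< , p′ = ∧⁻ {i <ᵇ order′} p ; _ , p″ = ∧⁻ {j <ᵇ order′} p′
                       _ , q′ = ∧⁻ {j <ᵇ order′} q ; l< , q″ = ∧⁻ {l <ᵇ order′} q′ in
                   ∧⁺ i< (∧⁺ l< (trans′ p″ q″))
      ; close  = λ {i} {j} → close′ i j
      ; size   = λ i< _ → size′ i<
      }
      where
      open Partition P
      R′ : Rel
      R′ i j = (i <ᵇ order′) ∧ (j <ᵇ order′) ∧ R (ι i) (ι j)
      close′ : ∀ i j → T (R′ i j) → T (near induced i j)
      close′ i j p with i< , q ← ∧⁻ {i <ᵇ order′} p with j< , s ← ∧⁻ {j <ᵇ order′} q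
                   with ∨⁻ {ι i ≡ᵇ ι j} (close s)
      ... | inj₂ aij = ∨⁺₂ {i ≡ᵇ j} aij
      ... | inj₁ e   = ∨⁺₁ (≡⇒≡ᵇ i j (trans (sym (proj₂ (proj₂ (ι-spec (<ᵇ⇒< i _ i<)))))
                         (trans (cong ρ (≡ᵇ⇒≡ (ι i) (ι j) e)) (proj₂ (proj₂ (ι-spec (<ᵇ⇒< j _ j<)))))))
      size′ : ∀ {i} → i < order′ → # order′ (R′ i) ≡ suc r
      size′ {i} i< = begin
        # order′ (R′ i)                                  ≡⟨ #-cong order′ (λ j j< → (λ p → proj₂ (∧⁻ {j <ᵇ order′} (proj₂ (∧⁻ {i <ᵇ order′} p))))
                                                              , λ q → ∧⁺ (<⇒<ᵇ i<) (∧⁺ (<⇒<ᵇ j<) q)) ⟩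
        # order′ (λ j → R (ι i) (ι j))                   ≡⟨ ∑-nth n kept (λ v → bit (R (ι i) v)) ⟩
        ∑ n (λ v → if kept v then bit (R (ι i) v) else 0) ≡⟨ ∑-cong n (λ v _ → drop v) ⟩
        # n (R (ι i))                                    ≡⟨ size (proj₁ (ι-spec i<)) (proj₁ (proj₂ (ι-spec i<))) ⟩
        suc r                                            ∎
        where
        open ≡-Reasoning
        drop : ∀ v → (if kept v then bit (R (ι i) v) else 0) ≡ bit (R (ι i) v)
        drop v with T? (kept v)
        ... | yes p = if-true p
        ... | no ¬p = trans (if-false ¬p) (cong bit (T-ext {false} ⊥-elim (λ q → ¬p (proj₂ (inside (sym′ q))))))

    -- The clique size is arbitrary here; that a solution of the reduced graph can be taken with the
    -- original size is settled afterwards, in `same-size`.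
    pull-back : ∀ {r} → Partition order′ induced all r → Partition n a kept r
    pull-back {r} P = record
      { R      = R′
      ; inside = λ {u} p → let u< , Wu , _ = R′⁻ {u} p in u< , Wu
      ; refl′  = λ u< Wu → R′⁺ (u< , Wu , u< , Wu , refl′ (ρ< u< Wu) tt)
      ; sym′   = λ {u} {v} p → let u< , Wu , v< , Wv , q = R′⁻ {u} {v} p in R′⁺ (v< , Wv , u< , Wu , sym′ q)
      ; trans′ = λ {u} {v} {w} p q →
                   let u< , Wu , _ , _ , p′ = R′⁻ {u} {v} p ; _ , _ , w< , Ww , q′ = R′⁻ {v} {w} q in
                   R′⁺ (u< , Wu , w< , Ww , trans′ p′ q′)
      ; close  = λ {u} {v} → close′ u v
      ; size   = size′
      }
      where
      open Partition P
      R′ : Rel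
      R′ u v = (u <ᵇ n) ∧ kept u ∧ (v <ᵇ n) ∧ kept v ∧ R (ρ u) (ρ v)
      R′⁻ : ∀ {u v} → T (R′ u v) → u < n × T (kept u) × v < n × T (kept v) × T (R (ρ u) (ρ v))
      R′⁻ {u} {v} p =
        let p₁ , q₁ = ∧⁻ {u <ᵇ n} p ; p₂ , q₂ = ∧⁻ {kept u} q₁
            p₃ , q₃ = ∧⁻ {v <ᵇ n} q₂ ; p₄ , q₄ = ∧⁻ {kept v} q₃
        in <ᵇ⇒< u n p₁ , p₂ , <ᵇ⇒< v n p₃ , p₄ , q₄
      R′⁺ : ∀ {u v} → u < n × T (kept u) × v < n × T (kept v) × T (R (ρ u) (ρ v)) → T (R′ u v)
      R′⁺ (p₁ , p₂ , p₃ , p₄ , p₅) = ∧⁺ (<⇒<ᵇ p₁) (∧⁺ p₂ (∧⁺ (<⇒<ᵇ p₃) (∧⁺ p₄ p₅)))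
      close′ : ∀ u v → T (R′ u v) → T (u ~ v)
      close′ u v p with u< , Wu , v< , Wv , q ← R′⁻ {u} {v} p with ∨⁻ {ρ u ≡ᵇ ρ v} (close q)
      ... | inj₁ e = ∨⁺₁ (≡⇒≡ᵇ u v (trans (sym (ι-ρ u< Wu)) (trans (cong ι (≡ᵇ⇒≡ (ρ u) (ρ v) e)) (ι-ρ v< Wv))))
      ... | inj₂ s = ∨⁺₂ {u ≡ᵇ v} (subst₂ (λ x y → T (a x y)) (ι-ρ u< Wu) (ι-ρ v< Wv) s)
      size′ : ∀ {u} → u < n → T (kept u) → # n (R′ u) ≡ suc r
      size′ {u} u< Wu = begin
        # n (R′ u)                                             ≡⟨ ∑-cong n drop ⟩
        ∑ n (λ v → if kept v then bit (R (ρ u) (ρ v)) else 0)  ≡⟨ ∑-nth n kept (λ v → bit (R (ρ u) (ρ v))) ⟨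
        # order′ (λ j → R (ρ u) (ρ (ι j)))                     ≡⟨ ∑-cong order′ (λ j j< → cong (bit ∘ R (ρ u)) (proj₂ (proj₂ (ι-spec j<)))) ⟩
        # order′ (R (ρ u))                                     ≡⟨ size (ρ< u< Wu) tt ⟩
        suc r                                                  ∎
        where
        open ≡-Reasoning
        drop : ∀ v → v < n → bit (R′ u v) ≡ (if kept v then bit (R (ρ u) (ρ v)) else 0)
        drop v v< with T? (kept v)
        ... | yes Wv = trans (cong bit (T-ext (λ p → proj₂ (proj₂ (proj₂ (proj₂ (R′⁻ {u} {v} p)))))
                         λ q → R′⁺ {u} {v} (u< , Wu , v< , Wv , q))) (sym (if-true Wv))
        ... | no ¬Wv = trans (cong bit (T-ext {_} {false} (λ p → ¬Wv (proj₁ (proj₂ (proj₂ (proj₂ (R′⁻ {u} {v} p)))))) ⊥-elim))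
                         (sym (if-false ¬Wv))

    -- Solutions of an accepted graph and of its reduction

    module Accepted {k} (large : k + k + (k + k) + (k + k) < n) (ok : T (accepts k)) where

      private
        ok₁ = ∧⁻ {volume <ᵇ suc (k + k + need)} ok
        ok₂ = ∧⁻ {need′ <ᵇ suc volume′} (proj₂ ok₁)
        ok₃ = ∧⁻ {volume′ <ᵇ suc (k + k + need′)} (proj₂ ok₂)

      volume≤ : volume ≤ k + k + n * r
      volume≤ = subst (λ x → volume ≤ k + k + x) need≡ (≤-pred (<ᵇ⇒< volume _ (proj₁ ok₁)))

      need′≤volume′ : need′ ≤ volume′
      need′≤volume′ = ≤-pred (<ᵇ⇒< need′ _ (proj₁ ok₂))

      slack≤ : volume′ ∸ need′ ≤ k + k
      slack≤ = ≤-trans (∸-monoˡ-≤ need′ (≤-pred (<ᵇ⇒< volume′ _ (proj₁ ok₃)))) (≤-reflexive (m+n∸n≡m (k + k) need′))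

      order′≤6k : order′ ≤ k + k + (k + k) + (k + k)
      order′≤6k = ≤-pred (<ᵇ⇒< order′ _ (proj₂ ok₃))

      ⌊slack/2⌋≤k : ⌊ volume′ ∸ need′ /2⌋ ≤ k
      ⌊slack/2⌋≤k = double-cancel-≤ (≤-trans (proj₁ (half-bounds (volume′ ∸ need′))) slack≤)

      -- The range `n` of the count is long enough, since half the slack is at most k < n.
      half≡ : half ≡ ⌊ volume′ ∸ need′ /2⌋
      half≡ = trans (∑-cong n λ i _ → cong bit (half-<ᵇ i (volume′ ∸ need′)))
        (#-< (≤-trans ⌊slack/2⌋≤k (<⇒≤ (≤-<-trans (≤-trans (m≤m+n k k) (≤-trans (m≤m+n (k + k) (k + k)) (m≤m+n _ (k + k)))) large))))

      half≤k : half ≤ k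
      half≤k = subst (_≤ k) (sym half≡) ⌊slack/2⌋≤k

      slack≤half : volume′ ∸ need′ ≤ suc (half + half)
      slack≤half = subst (λ h → volume′ ∸ need′ ≤ suc (h + h)) (sym half≡) (proj₂ (half-bounds (volume′ ∸ need′)))

      half≤slack : half + half ≤ volume′ ∸ need′
      half≤slack = subst (λ h → h + h ≤ volume′ ∸ need′) (sym half≡) (proj₁ (half-bounds (volume′ ∸ need′)))

      volume′≡ : volume′ ≡ (volume′ ∸ need′) + order′ * r
      volume′≡ = trans (sym (m∸n+n≡m need′≤volume′)) (cong (volume′ ∸ need′ +_) need′≡)

      -- The parameter is `suc half`, not `half`: it is positive, as an instance demands, and it
      -- absorbs the remainder of the halving, which avoids a parity argument.
      induce-solution : Partition n a kept r → Solution order′ induced (suc half)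
      induce-solution P = solution r (induce P) (begin
        ∑ order′ (degree order′ induced)                 ≡⟨ trans volume-induced volume′≡ ⟩
        (volume′ ∸ need′) + order′ * r                   ≤⟨ +-monoˡ-≤ (order′ * r) (≤-trans slack≤half (s≤s (+-monoʳ-≤ half (n≤1+n half)))) ⟩
        suc half + suc half + order′ * r                 ∎)
        where open ≤-Reasoning

      -- At most 6k < n vertices are kept, so one is dropped, and dropped vertices are forced by a
      -- center.
      C₀ : Center center₀
      C₀ = let v , _ , p = #-pos⁻ n 0<removed in find-center (¬kept⇒forced (not⁻ p))
        where
        0<removed : 0 < # n (not ∘ kept)
        0<removed = +-cancelˡ-< order′ 0 _ (subst₂ _<_ (sym (+-identityʳ order′)) (sym (#-not n kept))
          (≤-<-trans order′≤6k large))

      -- center₀ keeps its degree r, so r′ ≤ r; smaller cliques would cost at least order′ / 2 > 1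
      -- more deletions than cliques of size r + 1.
      module _ {v} (v<n : v < n) (Wv : T (kept v)) where

        free-vertex : ∃[ x ] x < n × T (free x)
        free-vertex = [ (λ q → v , v<n , q) , (λ q → any⁻ n (proj₁ (∧⁻ {someFree} q))) ]′ (∨⁻ {not (forced v)} Wv)

        x : ℕ
        x = proj₁ free-vertex
        x<n : x < n
        x<n = proj₁ (proj₂ free-vertex)
        free-x : T (free x)
        free-x = proj₂ (proj₂ free-vertex)

        near⊆kept : ∀ v → v < n → T (center₀ ~ v) → T (kept v)
        near⊆kept v _ p = ∨⁺₂ {not (forced v)} (∧⁺ (any⁺ n x<n free-x) p)

        r<order′ : suc r < order′
        r<order′ = subst (_< order′) (Center.#≡ C₀)
          (#-strict n {center₀ ~_} {kept} x<n near⊆kept (λ p → not⁻ free-x (forced⁺ C₀ p)) (∨⁺₁ free-x))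

        r′≤r : ∀ {r′} → Partition n a kept r′ → r′ ≤ r
        r′≤r {r′} P = ≤-pred (begin
          suc r′                        ≡⟨ Partition.size P c₀<n (near⊆kept center₀ c₀<n (near-refl a center₀)) ⟨
          # n (Partition.R P center₀)   ≤⟨ #-mono n (class⊆near P) ⟩
          # n (center₀ ~_)              ≡⟨ Center.#≡ C₀ ⟩
          suc r                         ∎)
          where
          open ≤-Reasoning
          c₀<n = Center.c<n C₀

      empty-partition : (∀ {u} → u < n → ¬ T (kept u)) → Partition n a kept r
      empty-partition none = record
        { R = λ _ _ → false ; inside = ⊥-elim ; refl′ = λ u< Wu → ⊥-elim (none u< Wu)
        ; sym′ = λ () ; trans′ = λ () ; close = ⊥-elim ; size = λ u< Wu → ⊥-elim (none u< Wu) }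

      -- If nothing is kept, r′ carries no information and the empty partition serves for r;
      -- otherwise r′ = r.
      same-size : ∀ {r′} → Partition n a kept r′ → volume′ ≤ suc half + suc half + order′ * r′ → Partition n a kept r
      same-size {r′} P budget = [ empty , nonempty ]′ (zero-or-pos order′)
        where
        zero-or-pos : ∀ m → m ≡ 0 ⊎ 0 < m
        zero-or-pos zero    = inj₁ refl
        zero-or-pos (suc m) = inj₂ (s≤s z≤n)
        empty : order′ ≡ 0 → Partition n a kept r
        empty z = empty-partition λ u< Wu → <⇒≢ (#-pos⁺ n {kept} u< Wu) (sym z)
        r′≡r : ∀ {v} → v < n → T (kept v) → r′ ≡ r
        r′≡r v<n Wv = [ (λ r′<r → ⊥-elim (smaller-too-costly volume′≡ half≤slack budget r′<r (r<order′ v<n Wv)))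
                      , (λ e → e) ]′ (m≤n⇒m<n∨m≡n (r′≤r v<n Wv P))
        nonempty : 0 < order′ → Partition n a kept r
        nonempty 0<order′ = let v , v<n , Wv = #-pos⁻ n {kept} 0<order′ in subst (Partition n a kept) (r′≡r v<n Wv) P

      -- Only the partition is transported. The original budget depends on r alone and has been
      -- tested by `accepts`.
      lift-solution : Solution order′ induced (suc half) → Solution n a k
      lift-solution (solution r′ P budget) = solution r
        (extend C₀ (same-size (pull-back P) (subst (_≤ suc half + suc half + order′ * r′) volume-induced budget)))
        volume≤

    accept : ∀ {k} → k + k + (k + k) + (k + k) < n → Solution n a k → T (accepts k) × Partition n a kept r
    accept {k} large (solution r₀ P budget) with refl ← Accept.r≡r₀ {k} large P budget =
      Accept′.accepted {k} large P budget , Accept′.restricted {k} large P budget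

-- The reduction as a program

addOp subOp : Op₂ nat nat nat
addOp = record { fun = _+_ ; expr = _⊕_ ; correct = λ _ _ _ _ _ → cong₂ _+_ }
subOp = record { fun = _∸_ ; expr = _⊖_ ; correct = λ _ _ _ _ _ → cong₂ _∸_ }

sucOp : Op₁ nat nat
sucOp = record { fun = suc ; expr = lit 1 ⊕_ ; correct = λ _ _ _ → cong suc }

-- Comparison by truncated subtraction: x < y when `suc x ∸ y` vanishes, x = y when both differences
-- vanish. Subtracting from 1 turns zero into true and any other number into false.
ltOp eqOp : Op₂ nat nat bool
ltOp = record
  { fun = _<ᵇ_
  ; expr = λ e f → lit 1 ⊖ (lit 1 ⊕ e ⊖ f)
  ; correct = λ { _ _ _ x y refl refl → lt x y }
  }
  where
  lt : ∀ x y → 1 ∸ (suc x ∸ y) ≡ bit (x <ᵇ y)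
  lt x       zero    = 0∸n≡0 x
  lt zero    (suc y) = cong (1 ∸_) (0∸n≡0 y)
  lt (suc x) (suc y) = lt x y
eqOp = record
  { fun = _≡ᵇ_
  ; expr = λ e f → lit 1 ⊖ ((e ⊖ f) ⊕ (f ⊖ e))
  ; correct = λ { _ _ _ x y refl refl → eq x y }
  }
  where
  eq : ∀ x y → 1 ∸ ((x ∸ y) + (y ∸ x)) ≡ bit (x ≡ᵇ y)
  eq zero    zero    = refl
  eq zero    (suc y) = 0∸n≡0 y
  eq (suc x) zero    = 0∸n≡0 (x + 0)
  eq (suc x) (suc y) = eq x y

notOp : Op₁ bool bool
notOp = record
  { fun = not
  ; expr = lit 1 ⊖_
  ; correct = λ { _ _ true p → cong (1 ∸_) p ; _ _ false p → cong (1 ∸_) p }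
  }

andOp orOp : Op₂ bool bool bool
andOp = record
  { fun = _∧_
  ; expr = λ e f → e ⊕ f ⊖ lit 1
  ; correct = λ _ _ _ x y p q → trans (cong₂ (λ x y → x + y ∸ 1) p q) (and x y)
  }
  where
  and : ∀ x y → bit x + bit y ∸ 1 ≡ bit (x ∧ y)
  and true  true  = refl
  and true  false = refl
  and false true  = refl
  and false false = refl
orOp = record
  { fun = _∨_
  ; expr = λ e f → lit 1 ⊖ (lit 1 ⊖ (e ⊕ f))
  ; correct = λ _ _ _ x y p q → trans (cong₂ (λ x y → 1 ∸ (1 ∸ (x + y))) p q) (or x y)
  }
  where
  or : ∀ x y → 1 ∸ (1 ∸ (bit x + bit y)) ≡ bit (x ∨ y)
  or true  true  = refl
  or true  false = refl
  or false true  = refl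
  or false false = refl

pattern v₀ = zero
pattern v₁ = suc v₀
pattern v₂ = suc v₁

module _ {m : ℕ} where

  infixl 6 _+ₜ_ _∸ₜ_
  infix  4 _<ₜ_ _≡ₜ_
  infixr 3 _∧ₜ_
  infixr 2 _∨ₜ_

  _+ₜ_ _∸ₜ_ : Tm nat m → Tm nat m → Tm nat m
  _+ₜ_ = ap₂ addOp
  _∸ₜ_ = ap₂ subOp

  sucₜ : Tm nat m → Tm nat m
  sucₜ = ap₁ sucOp

  _<ₜ_ _≡ₜ_ : Tm nat m → Tm nat m → Tm bool m
  _<ₜ_ = ap₂ ltOp
  _≡ₜ_ = ap₂ eqOp

  ¬ₜ_ : Tm bool m → Tm bool m
  ¬ₜ_ = ap₁ notOp

  _∧ₜ_ _∨ₜ_ : Tm bool m → Tm bool m → Tm bool m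
  _∧ₜ_ = ap₂ andOp
  _∨ₜ_ = ap₂ orOp

  #ₜ : Tm bool (suc m) → Tm nat m
  #ₜ b = sum (ite b (lit 1) (lit 0))

  anyₜ : Tm bool (suc m) → Tm bool m
  anyₜ b = lit 0 <ₜ #ₜ b

  orderₜ kₜ : Tm nat m
  orderₜ = input zero (lit 0)
  kₜ     = input zero (lit 1)

module Entry (tn : ∀ {m} → Tm nat m) (ta : ∀ {m} → Fin m → Fin m → Tm bool m) where

  -- Multiplication by repeated addition, correct while the first factor is at most the input order,
  -- the range of `sum`.
  timesₜ : ∀ {m} → Fin m → Fin m → Tm nat m
  timesₜ x y = sum (ite (var v₀ <ₜ var (suc x)) (var (suc y)) (lit 0))

  -- The position p = order * i + j of an entry is decoded into i and j.
  rowₜ : Tm nat 2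
  rowₜ = #ₜ (timesₜ v₁ v₀ +ₜ var v₁ <ₜ sucₜ (var v₂))

  columnₜ : Tm nat 3
  columnₜ = var v₂ ∸ₜ timesₜ v₁ v₀

  entryₜ : Tm bool 1
  entryₜ = bind tn (bind rowₜ (bind columnₜ (ta v₁ v₀)))

  module _ (I : Instance) {m : ℕ} (m≤n : m ≤ order (G I)) where

    times : ∀ y → ∑ (order (G I)) (λ x → if x <ᵇ m then y else 0) ≡ m * y
    times y = trans (∑-if (order (G I)) (_<ᵇ m) y) (cong (_* y) (#-< m≤n))

    module _ {u v : ℕ} (u<m : u < m) (v<m : v < m) where

      p : ℕ
      p = m * u + v

      -- The left side says that row x ends no later than position `p`; as v < m, this singles out
      -- the rows before `u`.
      below : ∀ x → (m * x + m <ᵇ suc p) ≡ (x <ᵇ u)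
      below x = T-ext
        (λ q → <⇒<ᵇ (≰⇒> λ u≤x → <⇒≱ (+-mono-≤-< (*-monoʳ-≤ m u≤x) v<m) (≤-pred (<ᵇ⇒< (m * x + m) _ q))))
        (λ q → <⇒<ᵇ (s≤s (≤-trans (≤-reflexive (trans (+-comm (m * x) m) (sym (*-suc m x))))
                  (≤-trans (*-monoʳ-≤ m (<ᵇ⇒< x u q)) (m≤m+n (m * u) v)))))

      ⟦row⟧ : ⟦ rowₜ ⟧ I (m ∷ p ∷ []) ≡ u
      ⟦row⟧ = trans (∑-cong (order (G I)) λ x _ → cong bit (trans (cong (λ z → z + m <ᵇ suc p) (times x)) (below x)))
                    (#-< (<⇒≤ (<-≤-trans u<m m≤n)))

      ⟦column⟧ : ⟦ columnₜ ⟧ I (u ∷ m ∷ p ∷ []) ≡ v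
      ⟦column⟧ = trans (cong (p ∸_) (times u)) (m+n∸m≡n (m * u) v)

      ⟦entry⟧ : (∀ {l} (ρ : Vec ℕ l) → ⟦ tn ⟧ I ρ ≡ m) →
                ⟦ entryₜ ⟧ I (p ∷ []) ≡ ⟦ ta v₁ v₀ ⟧ I (v ∷ u ∷ m ∷ p ∷ [])
      ⟦entry⟧ tn≡ rewrite tn≡ (p ∷ []) | ⟦row⟧ | ⟦column⟧ = refl

-- The inner sum is the order times x. The range tests guard against positions such as `center₀ₜ`,
-- which equals the order if there is no center: a column out of range would read the next row.
adjₜ : ∀ {m} → Fin m → Fin m → Tm bool m
adjₜ x y = (var x <ₜ orderₜ) ∧ₜ (var y <ₜ orderₜ) ∧ₜ (lit 0 <ₜ input v₁ (sum (var (suc x)) +ₜ var y))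

nearₜ : ∀ {m} → Fin m → Fin m → Tm bool m
nearₜ x y = (var x ≡ₜ var y) ∨ₜ adjₜ x y

degreeₜ : ∀ {m} → Fin m → Tm nat m
degreeₜ x = #ₜ (adjₜ (suc x) v₀)

minDegreeₜ : ∀ {m} → Tm nat m
minDegreeₜ = #ₜ (¬ₜ anyₜ (degreeₜ v₀ <ₜ sucₜ (var v₁)))

isCliqueₜ : ∀ {m} → Fin m → Tm bool m
isCliqueₜ c = ¬ₜ anyₜ (anyₜ (nearₜ (suc (suc c)) v₁ ∧ₜ nearₜ (suc (suc c)) v₀ ∧ₜ ¬ₜ nearₜ v₁ v₀))

excessₜ : ∀ {m} → Fin m → Tm nat m
excessₜ c = sum (ite (nearₜ (suc c) v₀) (degreeₜ v₀ ∸ₜ minDegreeₜ) (lit 0))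

centerₜ : ∀ {m} → Fin m → Tm bool m
centerₜ c = (degreeₜ c ≡ₜ minDegreeₜ) ∧ₜ isCliqueₜ c ∧ₜ (excessₜ c <ₜ sucₜ (minDegreeₜ ∸ₜ lit 1))

forcedₜ : ∀ {m} → Fin m → Tm bool m
forcedₜ v = anyₜ (centerₜ v₀ ∧ₜ nearₜ v₀ (suc v))

nthₜ : (∀ {m} → Fin m → Tm bool m) → ∀ {m} → Fin m → Tm nat m
nthₜ P i = #ₜ (#ₜ ((var v₀ <ₜ sucₜ (var v₁)) ∧ₜ P v₀) <ₜ sucₜ (var (suc i)))

center₀ₜ : ∀ {m} → Tm nat m
center₀ₜ = bind (lit 0) (nthₜ centerₜ v₀)

keptₜ : ∀ {m} → Fin m → Tm bool m
keptₜ v = ¬ₜ forcedₜ v ∨ₜ anyₜ (¬ₜ forcedₜ v₀) ∧ₜ bind center₀ₜ (nearₜ v₀ (suc v))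

order′ₜ volumeₜ volume′ₜ needₜ need′ₜ halfₜ 6kₜ : ∀ {m} → Tm nat m
order′ₜ  = #ₜ (keptₜ v₀)
volumeₜ  = sum (degreeₜ v₀)
volume′ₜ = sum (#ₜ (keptₜ v₁ ∧ₜ keptₜ v₀ ∧ₜ adjₜ v₁ v₀))
needₜ    = sum minDegreeₜ
need′ₜ   = sum (ite (keptₜ v₀) minDegreeₜ (lit 0))
halfₜ    = #ₜ (sucₜ (var v₀ +ₜ var v₀) <ₜ volume′ₜ ∸ₜ need′ₜ)
6kₜ      = (kₜ +ₜ kₜ) +ₜ (kₜ +ₜ kₜ) +ₜ (kₜ +ₜ kₜ)

acceptsₜ smallₜ : ∀ {m} → Tm bool m
acceptsₜ = (volumeₜ <ₜ sucₜ (kₜ +ₜ kₜ +ₜ needₜ)) ∧ₜ (need′ₜ <ₜ sucₜ volume′ₜ) ∧ₜ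
           (volume′ₜ <ₜ sucₜ (kₜ +ₜ kₜ +ₜ need′ₜ)) ∧ₜ (order′ₜ <ₜ sucₜ 6kₜ)
smallₜ   = orderₜ <ₜ sucₜ 6kₜ

inducedₜ rejectingₜ : ∀ {m} → Fin m → Fin m → Tm bool m
inducedₜ i j   = bind (nthₜ keptₜ i) (bind (nthₜ keptₜ (suc j)) (adjₜ v₁ v₀))
rejectingₜ i j = (var i <ₜ lit 3) ∧ₜ (var j <ₜ lit 3) ∧ₜ ¬ₜ (var i ≡ₜ var j)

-- Opaque, since unfolding these terms inside entryₜ makes conversion checking blow up.
opaque

  outAdjₜ : ∀ {m} → Fin m → Fin m → Tm bool m
  outAdjₜ i j = ite smallₜ (adjₜ i j) (ite acceptsₜ (inducedₜ i j) (rejectingₜ i j))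

  outOrderₜ outKₜ : ∀ {m} → Tm nat m
  outOrderₜ = ite smallₜ orderₜ (ite acceptsₜ order′ₜ (lit 4))
  outKₜ     = ite smallₜ kₜ (ite acceptsₜ (sucₜ halfₜ) (lit 1))

-- A triangle and an isolated vertex. Four vertices are within 6k because k is positive, and within
-- the order of any input with more than 6k vertices, as the output routine demands.
rejecting : Rel
rejecting i j = (i <ᵇ 3) ∧ (j <ᵇ 3) ∧ not (i ≡ᵇ j)

-- The isolated vertex forces r = 0, and the degree sum 6 exceeds the budget 2.
rejecting-no : ¬ Solution 4 rejecting 1
rejecting-no (solution r P budget)
  with ≤-pred (subst (_≤ 1) (size {3} ≤-refl tt) (#-mono 4 {R 3} {near rejecting 3} λ _ _ → close))
  where open Partition P
... | z≤n with () ← ≤-pred (≤-pred budget)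

-- The kernel of an instance

module _ (I : Instance) where

  n K : ℕ
  n = order (G I)
  K = k I

  -- Repeats the inner sum and the range tests of `adjₜ`, so that the term denotes this relation
  -- definitionally.
  matrix : Rel
  matrix u v = (u <ᵇ n) ∧ (v <ᵇ n) ∧ (0 <ᵇ encode I 1 (∑ n (λ _ → u) + v))

  encode-entry : ∀ x y → encode I 1 (n * toℕ x + toℕ y) ≡ bit (adj (G I) x y)
  encode-entry x y with n * toℕ x + toℕ y <? n * n
  ... | yes p = cong (λ (u , v) → bit (adj (G I) u v)) (trans (cong (remQuot n)
                  (toℕ-injective (trans (toℕ-fromℕ< p) (sym (toℕ-combine x y))))) (remQuot-combine x y))
  ... | no ¬p = ⊥-elim (¬p (subst (_< n * n) (toℕ-combine x y) (toℕ<n (combine x y))))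

  adj≡matrix : ∀ x y → adj (G I) x y ≡ matrix (toℕ x) (toℕ y)
  adj≡matrix x y = T-ext
    (λ p → ∧⁺ (<⇒<ᵇ (toℕ<n x)) (∧⁺ (<⇒<ᵇ (toℕ<n y)) (subst (λ e → T (0 <ᵇ e)) (sym entry) (pos⁺ p))))
    (λ p → pos⁻ (subst (λ e → T (0 <ᵇ e)) entry (proj₂ (∧⁻ {toℕ y <ᵇ n} (proj₂ (∧⁻ {toℕ x <ᵇ n} p))))))
    where
    entry : encode I 1 (∑ n (λ _ → toℕ x) + toℕ y) ≡ bit (adj (G I) x y)
    entry = trans (cong (λ z → encode I 1 (z + toℕ y)) (∑-const n (toℕ x))) (encode-entry x y)
    pos⁺ : ∀ {b} → T b → T (0 <ᵇ bit b)
    pos⁺ {true} _ = tt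
    pos⁻ : ∀ {b} → T (0 <ᵇ bit b) → T b
    pos⁻ {true} _ = tt

  matrix⁻ : ∀ {u v} → T (matrix u v) → ∃[ x ] ∃[ y ] toℕ x ≡ u × toℕ y ≡ v × T (adj (G I) x y)
  matrix⁻ {u} {v} p =
    let u< , q = ∧⁻ {u <ᵇ n} p ; v< , _ = ∧⁻ {v <ᵇ n} q
        x≡ = toℕ-fromℕ< (<ᵇ⇒< u n u<) ; y≡ = toℕ-fromℕ< (<ᵇ⇒< v n v<)
    in _ , _ , x≡ , y≡ , subst T (sym (adj≡matrix _ _)) (subst₂ (λ s t → T (matrix s t)) (sym x≡) (sym y≡) p)

  matrix-sym : ∀ {u v} → T (matrix u v) → T (matrix v u)
  matrix-sym {u} {v} p with x , y , refl , refl , q ← matrix⁻ {u} {v} p =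
    subst T (adj≡matrix y x) (subst T (EdgeSet.sym (edges (G I)) x y) q)

  matrix-irr : ∀ {u} → ¬ T (matrix u u)
  matrix-irr {u} p with x , y , refl , e , q ← matrix⁻ {u} {u} p with refl ← toℕ-injective e =
    subst T (EdgeSet.irrefl (edges (G I)) x) q

  matrix-inside : ∀ {u v} → T (matrix u v) → v < n
  matrix-inside {u} {v} p = <ᵇ⇒< v n (proj₁ (∧⁻ {v <ᵇ n} (proj₂ (∧⁻ {u <ᵇ n} p))))

  open Kernel n matrix
  open Properties matrix-sym matrix-irr matrix-inside

  6K : ℕ
  6K = K + K + (K + K) + (K + K)

  small : Bool
  small = n <ᵇ suc 6K

  outOrder outK : ℕ
  outOrder = if small then n else (if accepts K then order′ else 4)
  outK     = if small then K else (if accepts K then suc half else 1)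

  outAdj : Rel
  outAdj i j = if small then matrix i j else (if accepts K then induced i j else rejecting i j)

  opaque
    unfolding outAdjₜ outOrderₜ outKₜ

    ⟦outOrder⟧ : ∀ {m} (ρ : Vec ℕ m) → ⟦ outOrderₜ ⟧ I ρ ≡ outOrder
    ⟦outOrder⟧ ρ = refl

    ⟦outK⟧ : ⟦ outKₜ ⟧ I [] ≡ outK
    ⟦outK⟧ = refl

    ⟦outAdj⟧ : ∀ {m} (ρ : Vec ℕ m) i j → ⟦ outAdjₜ i j ⟧ I ρ ≡ outAdj (lookup ρ i) (lookup ρ j)
    ⟦outAdj⟧ ρ i j = refl

  ¬small⇒large : ¬ T small → 6K < n
  ¬small⇒large ¬s = ≰⇒> λ n≤ → ¬s (<⇒<ᵇ (s≤s n≤))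

  4≤n : ¬ T small → 4 ≤ n
  4≤n ¬s = <⇒≤ (≤-<-trans (+-mono-≤ (+-mono-≤ 2≤ 2≤) (z≤n {K + K})) (¬small⇒large ¬s))
    where
    2≤ : 2 ≤ K + K
    2≤ = +-mono-≤ (k>0 I) (k>0 I)

  case-out : ∀ {A : Set} (P : A → Set) {x y z : A} → (T small → P x) →
             (¬ T small → T (accepts K) → P y) → (¬ T small → ¬ T (accepts K) → P z) →
             P (if small then x else (if accepts K then y else z))
  case-out P {x} {y} {z} = go small (accepts K)
    where
    go : ∀ b c → (T b → P x) → (¬ T b → T c → P y) → (¬ T b → ¬ T c → P z) →
         P (if b then x else (if c then y else z))
    go true  _     f _ _ = f tt
    go false true  _ g _ = g (λ ()) tt
    go false false _ _ h = h (λ ()) (λ ())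

  -- Order, adjacency and parameter branch separately on the same two tests, so all three are split
  -- at once.
  outSolution : {S : Set} → (T small → S ⇔ Solution n matrix K) →
    (¬ T small → T (accepts K) → S ⇔ Solution order′ induced (suc half)) →
    (¬ T small → ¬ T (accepts K) → S ⇔ Solution 4 rejecting 1) →
    S ⇔ Solution outOrder outAdj outK
  outSolution {S} = go small (accepts K)
    where
    go : ∀ b c → (T b → S ⇔ Solution n matrix K) → (¬ T b → T c → S ⇔ Solution order′ induced (suc half)) →
         (¬ T b → ¬ T c → S ⇔ Solution 4 rejecting 1) →
         S ⇔ Solution (if b then n else (if c then order′ else 4))
                      (λ i j → if b then matrix i j else (if c then induced i j else rejecting i j))
                      (if b then K else (if c then suc half else 1))
    go true  _     f _ _ = f tt
    go false true  _ g _ = g (λ ()) tt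
    go false false _ _ h = h (λ ()) (λ ())

  outAdj-sym : ∀ u v → outAdj u v ≡ outAdj v u
  outAdj-sym u v = cong₂ (if small then_else_) (matrix≡ u v)
    (cong₂ (if accepts K then_else_) (matrix≡ _ _) (T-ext (flip u v) (flip v u)))
    where
    matrix≡ : ∀ u v → matrix u v ≡ matrix v u
    matrix≡ u v = T-ext matrix-sym matrix-sym
    flip : ∀ u v → T (rejecting u v) → T (rejecting v u)
    flip u v p = let u< , q = ∧⁻ {u <ᵇ 3} p ; v< , u≢v = ∧⁻ {v <ᵇ 3} q in
      ∧⁺ v< (∧⁺ u< (not⁺ λ e → not⁻ u≢v (≡⇒≡ᵇ u v (sym (≡ᵇ⇒≡ v u e)))))

  outAdj-irr : ∀ u → ¬ T (outAdj u u)
  outAdj-irr u = case-out (λ b → ¬ T b) (λ _ → matrix-irr) (λ _ _ → matrix-irr)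
    (λ _ _ p → not⁻ (proj₂ (∧⁻ {u <ᵇ 3} (proj₂ (∧⁻ {u <ᵇ 3} p)))) (≡⇒≡ᵇ u u refl))

  kernel : Instance
  kernel = inst
    (graph outOrder record
      { has    = λ x y → outAdj (toℕ x) (toℕ y)
      ; sym    = λ x y → outAdj-sym (toℕ x) (toℕ y)
      ; irrefl = λ x → T-ext {_} {false} (outAdj-irr (toℕ x)) ⊥-elim
      })
    outK
    (case-out (0 <_) (λ _ → k>0 I) (λ _ _ → s≤s z≤n) (λ _ _ → s≤s z≤n))

  UCED⇔Solution : UCED I ⇔ Solution n matrix K
  UCED⇔Solution = mk⇔ (UCED⇒Solution I matrix adj≡matrix)
    (Solution⇒UCED I matrix adj≡matrix (λ u v → T-ext matrix-sym matrix-sym) (λ _ → matrix-irr))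

  UCED-kernel⇔Solution : UCED kernel ⇔ Solution outOrder outAdj outK
  UCED-kernel⇔Solution = mk⇔ (UCED⇒Solution kernel outAdj (λ _ _ → refl))
    (Solution⇒UCED kernel outAdj (λ _ _ → refl) outAdj-sym outAdj-irr)

  kernel-equivalent : UCED I ⇔ UCED kernel
  kernel-equivalent = mk⇔
    (λ p → Equivalence.from UCED-kernel⇔Solution (Equivalence.to transfer (Equivalence.to UCED⇔Solution p)))
    (λ p → Equivalence.from UCED⇔Solution (Equivalence.from transfer (Equivalence.to UCED-kernel⇔Solution p)))
    where
    transfer : Solution n matrix K ⇔ Solution outOrder outAdj outK
    transfer = outSolution
      (λ _ → mk⇔ (λ s → s) (λ s → s))
      (λ ¬s ok → let module A = Accepted {K} (¬small⇒large ¬s) ok in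
        mk⇔ (λ s → A.induce-solution (proj₂ (accept {K} (¬small⇒large ¬s) s))) A.lift-solution)
      (λ ¬s ¬ok → mk⇔ (λ s → ⊥-elim (¬ok (proj₁ (accept {K} (¬small⇒large ¬s) s)))) (λ s → ⊥-elim (rejecting-no s)))

  outOrder≤n : outOrder ≤ n
  outOrder≤n = case-out (_≤ n) (λ _ → ≤-refl) (λ _ _ → #≤ n kept) (λ ¬s _ → 4≤n ¬s)

  outOrder≤6k : outOrder ≤ 6 * K
  outOrder≤6k = subst (outOrder ≤_) (six K) (case-out (_≤ 6K)
    (λ s → ≤-pred (<ᵇ⇒< n _ s))
    (λ ¬s ok → Accepted.order′≤6k {K} (¬small⇒large ¬s) ok)
    (λ _ _ → +-mono-≤ (+-mono-≤ 2≤ 2≤) (z≤n {K + K})))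
    where
    six : ∀ k → k + k + (k + k) + (k + k) ≡ 6 * k
    six = solve-∀
    2≤ : 2 ≤ K + K
    2≤ = +-mono-≤ (k>0 I) (k>0 I)

  outK≤ : outK ≤ 1 + K
  outK≤ = case-out (_≤ 1 + K) (λ _ → n≤1+n K) (λ ¬s ok → s≤s (Accepted.half≤k {K} (¬small⇒large ¬s) ok)) (λ _ _ → s≤s z≤n)

theorem56 : KernelWithAtMost (λ k → 6 * k) VerticesFor UCED
theorem56 = record
  { kernel         = kernel
  ; polynomialTime = Writer.polynomial-time outOrderₜ outKₜ (Entry.entryₜ outOrderₜ outAdjₜ) kernel outOrder≤n
                       (λ I → ⟦outOrder⟧ I []) ⟦outK⟧ entries
  ; equivalent     = kernel-equivalent
  ; order≤         = outOrder≤6k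
  -- The three outcomes have parameter k, `suc half` with `half` at most k, and 1.
  ; bound          = 1 +_
  ; computable     = 1 [ lit 0 ]≔ lit 1 ⊕ 0 [ lit 0 ] , λ m → _ , _ , assign , refl
  ; k′≤            = outK≤
  }
  where
  entries : ∀ I (x y : Fin (outOrder I)) →
            ⟦ Entry.entryₜ outOrderₜ outAdjₜ ⟧ I (outOrder I * toℕ x + toℕ y ∷ []) ≡ outAdj I (toℕ x) (toℕ y)
  entries I x y = trans (Entry.⟦entry⟧ outOrderₜ outAdjₜ I (outOrder≤n I) (toℕ<n x) (toℕ<n y) (⟦outOrder⟧ I))
                        (⟦outAdj⟧ I (toℕ y ∷ toℕ x ∷ _ ∷ _ ∷ []) v₁ v₀)
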